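{- Let $U$ be a $\kappa$-cut with sides $A_1,\dots,A_a$ ($a\ge 2$) and let $W\neq U$ be another $\kappa$-cut with sides $B_1,\dots,B_b$ ($b\ge 2$). Put $T=U\cap W$, $W_i=W\cap A_i$ and $U_j=U\cap B_j$. Then at least one of the following holds. (Laminar type) $W$ is a laminar cut of $U$, and there are indices $i^*,j^*$ with $B_{j^*}\setminus A_{i^*}=(U\setminus W)\cup\bigcup_{i\ne i^*}A_i$ and $A_{i^*}\setminus B_{j^*}=(W\setminus U)\cup\bigcup_{j\neq j^*}B_j$. (Wheel type) $a=b=2$ and $(T;U_1,W_1,U_2,W_2)$ forms a $4$-wheel with sectors $A_1\cap B_1$, $A_1\cap B_2$, $A_2\cap B_2$, $A_2\cap B_1$. (Crossing matching type) $a=b=2$ and, after possibly renaming the two sides of $U$ and/or of $W$, $A_1\cap B_1\ne\emptyset$, $A_2\cap B_2\neq\emptyset$, $A_1\cap B_2=\emptyset$; moreover $|W_2|=|U_1|>0$, $|W_1|=|U_2|>0$, $W$ is a crossing matching cut of $U$ in side $A_1$ with respect to $U_2$, and if in addition $A_2\cap B_1\neq\emptyset$ then $|U_1|\ge|U_2|$. (Small type) $U$ is $(\mathrm{I},\kappa-1)$-small and all small sides of $U$ are contained in $W$, or $W$ is $(\mathrm{I},\kappa-1)$-small and all small sides of $W$ are contained in $U$.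
   Context: Standing conventions: $G=(V,E)$ is a finite, simple, connected, undirected, non-complete graph with $n=|V|$; $\kappa$ is its vertex connectivity (minimum size of a vertex set whose removal disconnects $G$), and it is assumed that $\kappa<n/4$. A cut is a set $U\subset V$ such that the subgraph induced on $V\setminus U$ is disconnected; a $\kappa$-cut is a cut with exactly $\kappa$ vertices. A side of a cut $U$ is (the vertex set of) a connected component of the subgraph induced on $V\setminus U$. A set $S$ disconnects $P$ from the rest of the graph if $P\neq\emptyset$, $P\cap S=\emptyset$, $V\setminus(S\cup P)\ne\emptyset$ and every path from $P$ to $V\setminus(S\cup P)$ meets $S$. Laminar cut: if $U$ is a cut and $P$ a side of $U$, a cut $W$ with $W\subseteq U\cup P$ is a laminar cut of $U$ in side $P$; a laminar cut of $U$ is a laminar cut of $U$ in some side. Small cuts: a cut $U$ with sides $A_1,\dots,A_a$ is $(\mathrm{I},t)$-small if there is an index $i^\sharp$ with $\sum_{i\neq i^\sharp}|A_i|\le t$; then $A_{i^\sharp}$ is its large side and the other sides are its small sides. Wheels: for $w\ge4$ (indices taken modulo $w$), if $V$ is partitioned into pairwise disjoint sets $T,C_1,\dots,C_w,S_1,\dots,S_w$ with all $C_i,S_i$ nonempty ($T$ may be empty) such that for every $i$ the set $C_i\cup T\cup C_{i+2}$ is a $\kappa$-cut that disconnects $S_i\cup C_{i+1}\cup S_{i+1}$ from the rest of the graph, then $(T;C_1,\dots,C_w)$ forms a $w$-wheel with sectors $S_1,\dots,S_w$. Matching cuts: let $U$ be a cut, $A$ a side of $U$, $P\subseteq U$. A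 $\kappa$-cut $W$ is a matching cut of $U$ in side $A$ with respect to $P$ if (i) $U\setminus P\subseteq W\subseteq U\cup A$, (ii) $A\setminus W\neq\emptyset$, and (iii) $W$ disconnects $P\cup(V\setminus(U\cup A))$ from $A\setminus W$ (i.e., these sets are disjoint from $W$ and every path between them meets $W$). If $U$ has exactly two sides $A,B$ and $\emptyset\neq P\subseteq U$, a $\kappa$-cut $W$ is a crossing matching cut of $U$ in side $A$ with respect to $P$ if (i) $W\cap B\neq\emptyset$ and (ii) $(U\setminus P)\cup(W\cap A)$ is a matching cut of $U$ in side $A$ with respect to $P$. -}

module Defs where

open import Data.Fin.Base using (Fin; toℕ; cast)
open import Data.Fin.Patterns using (0F; 1F)
open import Data.Fin.Properties using (_≟_)
open import Data.Fin.Subset using (Subset; _∈_; _⊆_; ⊤; ∁; _∩_; _∪_; _─_; ⋃; ∣_∣; Nonempty; Empty)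
open import Data.List.Base using (List; []; _∷_; map; filter; allFin; sum)
open import Data.List.Relation.Unary.All using (All)
open import Data.List.Relation.Unary.Any using (Any)
open import Data.Nat.Base using (ℕ; suc; _≤_; _≥_; _>_; _∸_; NonZero)
open import Data.Nat.DivMod using (_mod_)
import Data.Vec.Base as Vec
open import Data.Product.Base using (Σ-syntax; ∃-syntax; _×_)
open import Data.Sum.Base using (_⊎_)
open import Function.Base using (_∘_)
open import Function.Bundles using (_⇔_)
open import Function.Definitions using (Injective)
open import Relation.Binary.Construct.Closure.ReflexiveTransitive using (Star; ε; _◅_)
open import Relation.Binary.Definitions using (Symmetric; Decidable)
open import Relation.Binary.PropositionalEquality.Core using (_≡_; _≢_; sym)
open import Relation.Nullary.Decidable.Core using (¬?)
open import Relation.Nullary.Negation.Core using (¬_)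

record Graph (n : ℕ) : Set₁ where
  field
    Adj      : Fin n → Fin n → Set
    adj?     : Decidable Adj
    symm     : Symmetric Adj
    loopless : ∀ v → ¬ Adj v v

module _ {n : ℕ} (G : Graph n) where
  open Graph G

  Complete : Set
  Complete = ∀ u v → u ≢ v → Adj u v

  -- Paths may repeat vertices; each one contains a simple path with the same
  -- ends, so connectedness and separation are unaffected.
  Path : Fin n → Fin n → Set
  Path = Star Adj

  -- Both ends are included.
  vertices : ∀ {u v} → Path u v → List (Fin n)
  vertices {u} ε       = u ∷ []
  vertices {u} (_ ◅ p) = u ∷ vertices p

  -- A path of the subgraph induced on X is a path of G all of whose vertices
  -- are in X; in particular JoinedIn X u v entails u ∈ X and v ∈ X.
  JoinedIn : Subset n → Fin n → Fin n → Set
  JoinedIn X u v = Σ[ p ∈ Path u v ] All (_∈ X) (vertices p)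

  ConnectedOn : Subset n → Set
  ConnectedOn X = ∀ u v → u ∈ X → v ∈ X → JoinedIn X u v

  DisconnectedOn : Subset n → Set
  DisconnectedOn X = ∃[ u ] ∃[ v ] (u ∈ X × v ∈ X × ¬ JoinedIn X u v)

  IsComponentOf : Subset n → Subset n → Set
  IsComponentOf X A = ∃[ u ] (u ∈ X × (∀ v → v ∈ A ⇔ JoinedIn X u v))

  Connected : Set
  Connected = ConnectedOn ⊤

  IsCut : Subset n → Set
  IsCut U = DisconnectedOn (∁ U)

  IsCutOfSize : ℕ → Subset n → Set
  IsCutOfSize k U = IsCut U × ∣ U ∣ ≡ k

  IsVertexConnectivity : ℕ → Set
  IsVertexConnectivity κ = (∃[ U ] IsCutOfSize κ U) × (∀ U → IsCut U → κ ≤ ∣ U ∣)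

  IsSide : Subset n → Subset n → Set
  IsSide U A = IsComponentOf (∁ U) A

  -- A lists the sides of U, each exactly once.
  record AreSides (U : Subset n) {a : ℕ} (A : Fin a → Subset n) : Set where
    field
      side       : ∀ i → IsSide U (A i)
      distinct   : Injective _≡_ _≡_ A
      exhaustive : ∀ P → IsSide U P → ∃[ i ] A i ≡ P

  AllPathsMeet : Subset n → Subset n → Subset n → Set
  AllPathsMeet S P Q = ∀ {x y} → x ∈ P → y ∈ Q → (p : Path x y) → Any (_∈ S) (vertices p)

  record DisconnectsFromRest (S P : Subset n) : Set where
    field
      nonempty      : Nonempty P
      disjoint      : Empty (P ∩ S)
      rest-nonempty : Nonempty (∁ (S ∪ P))
      separated     : AllPathsMeet S P (∁ (S ∪ P))

  record DisconnectsFrom (S P Q : Subset n) : Set where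
    field
      disjointˡ : Empty (P ∩ S)
      disjointʳ : Empty (Q ∩ S)
      separated : AllPathsMeet S P Q

  record IsLaminarCutInSide (U P W : Subset n) : Set where
    field
      cut       : IsCut U
      side      : IsSide U P
      other-cut : IsCut W
      contained : W ⊆ U ∪ P

  IsLaminarCut : Subset n → Subset n → Set
  IsLaminarCut U W = ∃[ P ] IsLaminarCutInSide U P W

  next : ∀ {w} .{{_ : NonZero w}} → Fin w → Fin w
  next {w} i = suc (toℕ i) mod w

  record IsWheel (κ : ℕ) {w : ℕ} .{{_ : NonZero w}}
                 (T : Subset n) (C S : Fin w → Subset n) : Set where
    field
      w≥4        : w ≥ 4
      C-nonempty : ∀ i → Nonempty (C i)
      S-nonempty : ∀ i → Nonempty (S i)
      T∩C        : ∀ i → Empty (T ∩ C i)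
      T∩S        : ∀ i → Empty (T ∩ S i)
      C∩S        : ∀ i j → Empty (C i ∩ S j)
      C∩C        : ∀ i j → i ≢ j → Empty (C i ∩ C j)
      S∩S        : ∀ i j → i ≢ j → Empty (S i ∩ S j)
      cover      : ∀ v → v ∈ T ⊎ (∃[ i ] v ∈ C i) ⊎ (∃[ i ] v ∈ S i)
      cut        : ∀ i → IsCutOfSize κ (C i ∪ T ∪ C (next (next i)))
      separated  : ∀ i → DisconnectsFromRest (C i ∪ T ∪ C (next (next i)))
                                             (S i ∪ C (next i) ∪ S (next i))

  record IsMatchingCut (κ : ℕ) (U A P W : Subset n) : Set where
    field
      cut       : IsCut U
      side      : IsSide U A
      P⊆U       : P ⊆ U
      κ-cut     : IsCutOfSize κ W
      lower     : (U ─ P) ⊆ W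
      upper     : W ⊆ U ∪ A
      nonempty  : Nonempty (A ─ W)
      separated : DisconnectsFrom W (P ∪ ∁ (U ∪ A)) (A ─ W)

  -- A is the side in which W is a crossing matching cut, B the other side.
  record IsCrossingMatchingCut (κ : ℕ) (U A B P W : Subset n) : Set where
    field
      cut        : IsCut U
      side-A     : IsSide U A
      side-B     : IsSide U B
      A≢B        : A ≢ B
      only-sides : ∀ Q → IsSide U Q → Q ≡ A ⊎ Q ≡ B
      P-nonempty : Nonempty P
      P⊆U        : P ⊆ U
      κ-cut      : IsCutOfSize κ W
      crosses    : Nonempty (W ∩ B)
      matching   : IsMatchingCut κ U A P ((U ─ P) ∪ (W ∩ A))

module _ {n : ℕ} where

  others : ∀ {a} → Fin a → List (Fin a)
  others {a} i = filter (λ j → ¬? (j ≟ i)) (allFin a)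

  ⋃-others : ∀ {a} → (Fin a → Subset n) → Fin a → Subset n
  ⋃-others A i = ⋃ (map A (others i))

  -- A cut with sides A is (I,t)-small when some i♯ satisfies IsLargeSide t A i♯;
  -- its small sides are then the A i with i ≢ i♯.
  IsLargeSide : ℕ → ∀ {a} → (Fin a → Subset n) → Fin a → Set
  IsLargeSide t A i♯ = sum (map (∣_∣ ∘ A) (others i♯)) ≤ t

  SmallWithSmallSidesIn : ℕ → ∀ {a} → (Fin a → Subset n) → Subset n → Set
  SmallWithSmallSidesIn t A W = ∃[ i♯ ] (IsLargeSide t A i♯ × (∀ i → i ≢ i♯ → A i ⊆ W))

module _ {n : ℕ} (G : Graph n) (κ : ℕ)
         (U : Subset n) {a : ℕ} (A : Fin a → Subset n)
         (W : Subset n) {b : ℕ} (B : Fin b → Subset n) where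

  LaminarType : Set
  LaminarType =
    IsLaminarCut G U W
    × ∃[ i* ] ∃[ j* ]
        ( (B j* ─ A i*) ≡ (U ─ W) ∪ ⋃-others A i*
        × (A i* ─ B j*) ≡ (W ─ U) ∪ ⋃-others B j* )

  WheelType : Set
  WheelType =
    Σ[ a≡2 ∈ a ≡ 2 ] Σ[ b≡2 ∈ b ≡ 2 ]
      let A₁ = A (cast (sym a≡2) 0F)
          A₂ = A (cast (sym a≡2) 1F)
          B₁ = B (cast (sym b≡2) 0F)
          B₂ = B (cast (sym b≡2) 1F)
      in IsWheel G κ {4} (U ∩ W)
           (Vec.lookup (U ∩ B₁ Vec.∷ W ∩ A₁ Vec.∷ U ∩ B₂ Vec.∷ W ∩ A₂ Vec.∷ Vec.[]))
           (Vec.lookup (A₁ ∩ B₁ Vec.∷ A₁ ∩ B₂ Vec.∷ A₂ ∩ B₂ Vec.∷ A₂ ∩ B₁ Vec.∷ Vec.[]))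

  -- The choice of i₁ i₂ j₁ j₂ is the renaming of the sides.
  CrossingMatchingType : Set
  CrossingMatchingType =
    a ≡ 2 × b ≡ 2
    × ∃[ i₁ ] ∃[ i₂ ] ∃[ j₁ ] ∃[ j₂ ]
        ( i₁ ≢ i₂ × j₁ ≢ j₂
        × Nonempty (A i₁ ∩ B j₁)
        × Nonempty (A i₂ ∩ B j₂)
        × Empty (A i₁ ∩ B j₂)
        × ∣ W ∩ A i₂ ∣ ≡ ∣ U ∩ B j₁ ∣
        × ∣ U ∩ B j₁ ∣ > 0
        × ∣ W ∩ A i₁ ∣ ≡ ∣ U ∩ B j₂ ∣
        × ∣ U ∩ B j₂ ∣ > 0
        × IsCrossingMatchingCut G κ U (A i₁) (A i₂) (U ∩ B j₂) W
        × (Nonempty (A i₂ ∩ B j₁) → ∣ U ∩ B j₁ ∣ ≥ ∣ U ∩ B j₂ ∣) )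

  -- κ ∸ 1 is κ - 1, since κ ≥ 1 for a connected graph.
  SmallType : Set
  SmallType = SmallWithSmallSidesIn (κ ∸ 1) A W ⊎ SmallWithSmallSidesIn (κ ∸ 1) B U

{-# OPTIONS --safe #-}
-- Call A i ∩ B j a corner. A nonempty corner is separated from the rest of G by
-- its boundary (U ∩ B j) ∪ T ∪ (W ∩ A i), which therefore has at least κ vertices.
--   * If some A i misses W, it lies in one B j*, and so does U ∖ W, because by
--     minimality of κ every vertex of U has a neighbour in A i. The same argument
--     for a side of W other than B j* gives the laminar type.
--   * Otherwise all W ∩ A i and U ∩ B j are nonempty. If two nonempty corners lie
--     in different rows and columns, their boundaries have union inside U ∪ W and
--     intersection inside T, hence sizes adding up to at most 2κ. So both are
--     minimum cuts and no third side of U or W exists: wheel or crossing matching.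
--   * Otherwise all nonempty corners lie in one row or one column, and all sides
--     of the other rows (columns) are contained in W (in U): small type.
module Submission where

open import Data.Fin.Base using (Fin; zero; suc; inject≤)
open import Data.Fin.Patterns using (0F; 1F; 2F; 3F)
open import Data.Fin.Properties using (_≟_; any?; sequence)
open import Data.Fin.Subset using (Subset; inside; outside; _∈_; _∉_; _⊆_; ∁; _∩_; _∪_; _─_; _-_; ⊥; ⋃; ∣_∣; Nonempty; Empty)
open import Data.Fin.Subset.Properties
  using (_∈?_; nonempty?; ∉⊥; ∣⊥∣≡0; Empty-unique; ⊆-antisym
        ; p⊆q⇒∣p∣≤∣q∣; p⊂q⇒∣p∣<∣q∣; x∈∁p⇒x∉p; x∉p⇒x∈∁p
        ; x∈p∩q⁺; x∈p∩q⁻; ∩-comm; x∈p∪q⁺; x∈p∪q⁻; p⊆p∪q; q⊆p∪q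
        ; x∈p∧x∉q⇒x∈p─q; p─q⊆p; x∈p∧x≢y⇒x∈p-y; x∈p⇒∣p-x∣<∣p∣)
open import Data.List.Base using (List; []; _∷_; map; allFin)
open import Data.List.Membership.Propositional using () renaming (_∈_ to _∈ₗ_)
open import Data.List.Membership.Propositional.Properties using (∈-filter⁺; ∈-filter⁻; ∈-allFin)
open import Data.List.Relation.Unary.All as All using ([]; _∷_)
open import Data.List.Relation.Unary.Any using (Any; here; there)
open import Data.List.Relation.Unary.AllPairs using ([]; _∷_)
open import Data.List.Relation.Unary.Unique.Propositional using (Unique)
open import Data.List.Relation.Unary.Unique.Propositional.Properties using (allFin⁺; filter⁺)
open import Data.Nat.Base using (ℕ; _+_; _*_; _∸_; _≤_; _<_; _≥_; _>_; suc; z≤n; s≤s)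
open import Data.Nat.ListAction using (sum)
open import Data.Nat.Properties
  using (+-comm; +-assoc; +-suc; +-identityʳ; +-cancelˡ-≡; +-cancelˡ-≤; +-cancelʳ-≤; +-mono-≤; +-mono-<-≤; +-monoʳ-≤
        ; ≤-refl; ≤-trans; ≤-antisym; ≤-reflexive; <-irrefl; <-≤-trans; ≤-<-trans; <⇒≱; pred-mono-≤; module ≤-Reasoning)
open import Data.Product.Base using (∃-syntax; _×_; _,_; proj₁; proj₂)
open import Data.Sum.Base using (_⊎_; inj₁; inj₂; [_,_]′; swap)
open import Data.Vec.Base using ([]; _∷_; here; there; tabulate; lookup)
open import Data.Vec.Properties using ([]=⇒lookup; lookup⇒[]=; lookup∘tabulate)
open import Effect.Monad using (RawMonad)
open import Function.Base using (_∘_)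
open import Function.Bundles using (_⇔_; mk⇔; module Equivalence)
open import Relation.Binary.Construct.Closure.ReflexiveTransitive using (ε; _◅_)
open import Relation.Binary.PropositionalEquality.Core using (_≡_; _≢_; refl; sym; trans; cong; cong₂; subst; subst₂; ≢-sym)
open import Relation.Binary.PropositionalEquality.Properties using (module ≡-Reasoning)
open import Relation.Nullary.Decidable using (Dec; yes; no; does; ¬?; _×-dec_; decidable-stable; dec-true; toSum; ¬¬-excluded-middle)
open import Relation.Nullary.Negation using (¬_; contradiction; ¬¬-Monad; ¬¬-map)
open import Defs

-- Finite sets

x∈p─q⇒x∉q : ∀ {n x} (p q : Subset n) → x ∈ p ─ q → x ∉ q
x∈p─q⇒x∉q (_ ∷ p) (outside ∷ q) (there x∈) (there x∈q) = x∈p─q⇒x∉q p q x∈ x∈q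
x∈p─q⇒x∉q (_ ∷ p) (inside ∷ q)  (there x∈) (there x∈q) = x∈p─q⇒x∉q p q x∈ x∈q

∣p∪q∣+∣p∩q∣≡∣p∣+∣q∣ : ∀ {n} (p q : Subset n) → ∣ p ∪ q ∣ + ∣ p ∩ q ∣ ≡ ∣ p ∣ + ∣ q ∣
∣p∪q∣+∣p∩q∣≡∣p∣+∣q∣ []            []            = refl
∣p∪q∣+∣p∩q∣≡∣p∣+∣q∣ (outside ∷ p) (outside ∷ q) = ∣p∪q∣+∣p∩q∣≡∣p∣+∣q∣ p q
∣p∪q∣+∣p∩q∣≡∣p∣+∣q∣ (inside ∷ p)  (outside ∷ q) = cong suc (∣p∪q∣+∣p∩q∣≡∣p∣+∣q∣ p q)
∣p∪q∣+∣p∩q∣≡∣p∣+∣q∣ (outside ∷ p) (inside ∷ q)  =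
  trans (cong suc (∣p∪q∣+∣p∩q∣≡∣p∣+∣q∣ p q)) (sym (+-suc ∣ p ∣ ∣ q ∣))
∣p∪q∣+∣p∩q∣≡∣p∣+∣q∣ (inside ∷ p)  (inside ∷ q)  =
  cong suc (trans (+-suc ∣ p ∪ q ∣ ∣ p ∩ q ∣)
                  (trans (cong suc (∣p∪q∣+∣p∩q∣≡∣p∣+∣q∣ p q)) (sym (+-suc ∣ p ∣ ∣ q ∣))))

disjoint⇒∣p∪q∣≡∣p∣+∣q∣ : ∀ {n} (p q : Subset n) → Empty (p ∩ q) → ∣ p ∪ q ∣ ≡ ∣ p ∣ + ∣ q ∣
disjoint⇒∣p∪q∣≡∣p∣+∣q∣ {n} p q p∩q=∅ = begin
  ∣ p ∪ q ∣             ≡⟨ +-identityʳ _ ⟨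
  ∣ p ∪ q ∣ + 0         ≡⟨ cong (∣ p ∪ q ∣ +_) (∣⊥∣≡0 n) ⟨
  ∣ p ∪ q ∣ + ∣ ⊥ {n} ∣ ≡⟨ cong (λ r → ∣ p ∪ q ∣ + ∣ r ∣) (Empty-unique p∩q=∅) ⟨
  ∣ p ∪ q ∣ + ∣ p ∩ q ∣ ≡⟨ ∣p∪q∣+∣p∩q∣≡∣p∣+∣q∣ p q ⟩
  ∣ p ∣ + ∣ q ∣         ∎
  where open ≡-Reasoning

Nonempty⇒∣p∣>0 : ∀ {n} {p : Subset n} → Nonempty p → ∣ p ∣ > 0
Nonempty⇒∣p∣>0 {p = p} (_ , x∈p) = ≤-<-trans z≤n (x∈p⇒∣p-x∣<∣p∣ x∈p)

-- Supplies the `Subset` of a component once joinedness to its root has been decided for every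
-- vertex.
comprehension : ∀ {n} {P : Fin n → Set} → (∀ x → Dec (P x)) → ∃[ p ] (∀ x → x ∈ p ⇔ P x)
comprehension {n} {P} P? = p , λ x → mk⇔ (to x) (from x)
  where
  p = tabulate (does ∘ P?)
  to : ∀ x → x ∈ p → P x
  to x x∈p with P? x | trans (sym (lookup∘tabulate (does ∘ P?) x)) ([]=⇒lookup x∈p)
  ... | yes px | _ = px
  from : ∀ x → P x → x ∈ p
  from x px = lookup⇒[]= x p (trans (lookup∘tabulate (does ∘ P?) x) (dec-true (P? x) px))

module _ {n a : ℕ} (A : Fin a → Subset n) where

  x∈⋃map⁺ : ∀ {x i} (is : List (Fin a)) → i ∈ₗ is → x ∈ A i → x ∈ ⋃ (map A is)
  x∈⋃map⁺ (_ ∷ is) (here refl) x∈ = p⊆p∪q _ x∈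
  x∈⋃map⁺ (_ ∷ is) (there i∈)  x∈ = q⊆p∪q _ _ (x∈⋃map⁺ is i∈ x∈)

  x∈⋃map⁻ : ∀ {x} (is : List (Fin a)) → x ∈ ⋃ (map A is) → ∃[ i ] (i ∈ₗ is × x ∈ A i)
  x∈⋃map⁻ []       x∈ = contradiction x∈ ∉⊥
  x∈⋃map⁻ (i ∷ is) x∈ with x∈p∪q⁻ (A i) (⋃ (map A is)) x∈
  ... | inj₁ x∈A = i , here refl , x∈A
  ... | inj₂ x∈⋃ with x∈⋃map⁻ is x∈⋃
  ...   | j , j∈ , x∈A = j , there j∈ , x∈A

  x∈⋃-others⁺ : ∀ {x i j} → j ≢ i → x ∈ A j → x ∈ ⋃-others A i
  x∈⋃-others⁺ {i = i} {j} j≢i = x∈⋃map⁺ (others {n} i) (∈-filter⁺ (λ k → ¬? (k ≟ i)) (∈-allFin j) j≢i)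

  x∈⋃-others⁻ : ∀ {x} i → x ∈ ⋃-others A i → ∃[ j ] (j ≢ i × x ∈ A j)
  x∈⋃-others⁻ i x∈ with x∈⋃map⁻ (others {n} i) x∈
  ... | j , j∈ , x∈A = j , proj₂ (∈-filter⁻ (λ k → ¬? (k ≟ i)) {xs = allFin a} j∈) , x∈A

  module _ (disjoint : ∀ {x i j} → x ∈ A i → x ∈ A j → i ≡ j) where

    -- Turns the sum in `IsLargeSide` into the size of one set, so that smallness can be read off
    -- from a strict inclusion in the other cut.
    sum≡∣⋃∣ : ∀ {is} → Unique is → sum (map (∣_∣ ∘ A) is) ≡ ∣ ⋃ (map A is) ∣
    sum≡∣⋃∣ [] = sym (∣⊥∣≡0 n)
    sum≡∣⋃∣ {i ∷ is} (i∉is ∷ uniq) =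
      trans (cong (∣ A i ∣ +_) (sum≡∣⋃∣ uniq)) (sym (disjoint⇒∣p∪q∣≡∣p∣+∣q∣ (A i) (⋃ (map A is)) separate))
      where
      separate : Empty (A i ∩ ⋃ (map A is))
      separate (x , x∈) with x∈p∩q⁻ (A i) (⋃ (map A is)) x∈
      ... | x∈A , x∈⋃ with x∈⋃map⁻ is x∈⋃
      ...   | j , j∈ , x∈Aj = All.lookup i∉is j∈ (disjoint x∈A x∈Aj)

    sum-others≡∣⋃-others∣ : ∀ i → sum (map (∣_∣ ∘ A) (others {n} i)) ≡ ∣ ⋃-others A i ∣
    sum-others≡∣⋃-others∣ i = sum≡∣⋃∣ (filter⁺ (λ k → ¬? (k ≟ i)) (allFin⁺ a))

another : ∀ {a} → a ≥ 2 → (i : Fin a) → ∃[ j ] j ≢ i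
another (s≤s (s≤s _)) zero    = 1F , λ ()
another (s≤s (s≤s _)) (suc i) = 0F , λ ()

-- Pigeonhole: `0F`, `1F` and `2F` cannot all be among two values, which rules out `a` of at least
-- 3.
two-valued⇒2 : ∀ {a} → a ≥ 2 → (i j : Fin a) → (∀ k → k ≡ i ⊎ k ≡ j) → a ≡ 2
two-valued⇒2 {suc (suc 0)}             _ _ _ _ = refl
two-valued⇒2 {suc (suc (suc a))} _ i j two with two 0F | two 1F | two 2F
... | inj₁ refl | inj₁ ()   | _
... | inj₁ refl | inj₂ refl | inj₁ ()
... | inj₁ refl | inj₂ refl | inj₂ ()
... | inj₂ refl | inj₂ ()   | _
... | inj₂ refl | inj₁ refl | inj₁ ()
... | inj₂ refl | inj₁ refl | inj₂ ()
two-valued⇒2 {suc 0} (s≤s ()) _ _ _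

module _ {n : ℕ} (G : Graph n) where
  open Graph G

  -- Separation

  -- The edgewise form of separation: it is checked on single edges, and the statements about whole
  -- paths follow by induction along the path.
  Encloses : Subset n → Subset n → Set
  Encloses S P = ∀ {x y} → x ∈ P → Adj x y → y ∈ P ⊎ y ∈ S

  first∈ : ∀ {S : Subset n} {x y} → x ∈ S → (p : Path G x y) → Any (_∈ S) (vertices G p)
  first∈ x∈S ε       = here x∈S
  first∈ x∈S (_ ◅ _) = here x∈S

  -- The first vertex of the path outside `P` is reached by an edge from `P`, so `Encloses` places
  -- it in `S`.
  leaving-meets : ∀ {S P x y} → Encloses S P → x ∈ P → y ∉ P → (p : Path G x y) → Any (_∈ S) (vertices G p)
  leaving-meets enc x∈P y∉P ε = contradiction x∈P y∉P
  leaving-meets enc x∈P y∉P (e ◅ p) with enc x∈P e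
  ... | inj₁ z∈P = there (leaving-meets enc z∈P y∉P p)
  ... | inj₂ z∈S = there (first∈ z∈S p)

  -- The last vertex before the path first enters `P` is adjacent to a vertex of `P`, so by symmetry
  -- of `Adj` it lies in `S`. This direction serves matching cuts, where the paths end in the
  -- enclosed piece.
  entering-meets : ∀ {S P x y} → Encloses S P → x ∉ P → y ∈ P → (p : Path G x y) → Any (_∈ S) (vertices G p)
  entering-meets enc x∉P y∈P ε = contradiction y∈P x∉P
  entering-meets {P = P} enc x∉P y∈P (_◅_ {j = z} e p) with z ∈? P
  ... | no z∉P  = there (entering-meets enc z∉P y∈P p)
  ... | yes z∈P with enc z∈P (symm e)
  ...   | inj₁ x∈P = contradiction x∈P x∉P
  ...   | inj₂ x∈S = here x∈S

  encloses⇒disconnects : ∀ {S P} → Encloses S P → Nonempty P → Empty (P ∩ S) → Nonempty (∁ (S ∪ P)) →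
                         DisconnectsFromRest G S P
  encloses⇒disconnects {S} enc P≠∅ P∩S=∅ rest = record
    { nonempty      = P≠∅
    ; disjoint      = P∩S=∅
    ; rest-nonempty = rest
    ; separated     = λ x∈P y∈ → leaving-meets enc x∈P (x∈∁p⇒x∉p y∈ ∘ q⊆p∪q S _)
    }

  disconnects⇒cut : ∀ {S P} → DisconnectsFromRest G S P → IsCut G S
  disconnects⇒cut {S} {P} D = u , z , x∉p⇒x∈∁p u∉S , x∉p⇒x∈∁p (z∉ ∘ p⊆p∪q P) , unjoined
    where
    open DisconnectsFromRest D
    u = proj₁ nonempty
    z = proj₁ rest-nonempty
    u∉S : u ∉ S
    u∉S u∈S = disjoint (u , x∈p∩q⁺ (proj₂ nonempty , u∈S))
    z∉ : z ∉ S ∪ P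
    z∉ = x∈∁p⇒x∉p (proj₂ rest-nonempty)
    unjoined : ¬ JoinedIn G (∁ S) u z
    unjoined (p , avoids) =
      let v∉S , v∈S = All.lookupAny avoids (separated (proj₂ nonempty) (proj₂ rest-nonempty) p)
      in x∈∁p⇒x∉p v∉S v∈S

  -- Sides of a minimum cut

  head∈ : ∀ {X u v} → JoinedIn G X u v → u ∈ X
  head∈ (ε     , u∈ ∷ _) = u∈
  head∈ (_ ◅ _ , u∈ ∷ _) = u∈

  last∈ : ∀ {X u v} → JoinedIn G X u v → v ∈ X
  last∈ (ε     , v∈ ∷ _) = v∈
  last∈ (e ◅ p , _ ∷ all) = last∈ (p , all)

  joined-snoc : ∀ {X u v w} → JoinedIn G X u v → Adj v w → w ∈ X → JoinedIn G X u w
  joined-snoc (ε , u∈ ∷ _) e w∈ = e ◅ ε , u∈ ∷ w∈ ∷ []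
  joined-snoc (e′ ◅ p , u∈ ∷ all) e w∈ with joined-snoc (p , all) e w∈
  ... | q , all′ = e′ ◅ q , u∈ ∷ all′

  joined-sym : ∀ {X u v} → JoinedIn G X u v → JoinedIn G X v u
  joined-sym (ε , all) = ε , all
  joined-sym (e ◅ p , u∈ ∷ all) = joined-snoc (joined-sym (p , all)) (symm e) u∈

  joined-trans : ∀ {X u v w} → JoinedIn G X u v → JoinedIn G X v w → JoinedIn G X u w
  joined-trans (ε , _) q = q
  joined-trans (e ◅ p , u∈ ∷ all) q with joined-trans (p , all) q
  ... | r , all′ = e ◅ r , u∈ ∷ all′

  -- Joinedness is not shown to be decidable: finitely many instances of it are
  -- decided under a double negation, which suffices for stable conclusions.
  ¬¬-component : ∀ {X u} → u ∈ X → ¬ ¬ (∃[ P ] (IsComponentOf G X P × u ∈ P))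
  ¬¬-component {X} {u} u∈X =
    ¬¬-map component (sequence (RawMonad.rawApplicative ¬¬-Monad) (λ v → ¬¬-excluded-middle {A = JoinedIn G X u v}))
    where
    component : (∀ v → Dec (JoinedIn G X u v)) → ∃[ P ] (IsComponentOf G X P × u ∈ P)
    component joined? =
      let P , P⇔ = comprehension joined?
      in P , (u , u∈X , P⇔) , Equivalence.from (P⇔ u) (ε , u∈X ∷ [])

  -- Bundled per cut, so that each lemma on an ordered pair of cuts can be reused with the two
  -- exchanged.
  record IsMinimumCut (κ : ℕ) (U : Subset n) {a : ℕ} (A : Fin a → Subset n) : Set where
    field
      minimal : ∀ S → IsCut G S → κ ≤ ∣ S ∣
      κ-cut   : IsCutOfSize G κ U
      sides   : AreSides G U A
      a≥2     : a ≥ 2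

    open AreSides sides public

    size : ∣ U ∣ ≡ κ
    size = proj₂ κ-cut

    module _ {i : Fin a} where

      root : Fin n
      root = proj₁ (side i)

      joined : ∀ {v} → v ∈ A i → JoinedIn G (∁ U) root v
      joined {v} = Equivalence.to (proj₂ (proj₂ (side i)) v)

      ∈side : ∀ {v} → JoinedIn G (∁ U) root v → v ∈ A i
      ∈side {v} = Equivalence.from (proj₂ (proj₂ (side i)) v)

    side-nonempty : ∀ i → Nonempty (A i)
    side-nonempty i = root {i} , ∈side (ε , proj₁ (proj₂ (side i)) ∷ [])

    side∌ : ∀ {i x} → x ∈ A i → x ∉ U
    side∌ x∈ = x∈∁p⇒x∉p (last∈ (joined x∈))

    -- The component of `x` is available only under a double negation, but membership in one of
    -- finitely many sides is decidable, hence stable.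
    cover : ∀ {x} → x ∉ U → ∃[ i ] x ∈ A i
    cover {x} x∉U = decidable-stable (any? (λ i → x ∈? A i))
      (¬¬-map (λ (P , P-side , x∈P) → let i , Ai≡P = exhaustive P P-side in i , subst (x ∈_) (sym Ai≡P) x∈P)
              (¬¬-component (x∉p⇒x∈∁p x∉U)))

    closed : ∀ {i x y} → x ∈ A i → Adj x y → y ∉ U → y ∈ A i
    closed x∈ e y∉U = ∈side (joined-snoc (joined x∈) e (x∉p⇒x∈∁p y∉U))

    -- Joinedness is symmetric and transitive, so sides with a common vertex have the same vertices;
    -- `distinct` then identifies their indices.
    disjoint : ∀ {x i j} → x ∈ A i → x ∈ A j → i ≡ j
    disjoint {x} x∈i x∈j = distinct (⊆-antisym (into x∈i x∈j) (into x∈j x∈i))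
      where
      into : ∀ {i j} → x ∈ A i → x ∈ A j → A i ⊆ A j
      into x∈i x∈j y∈i = ∈side (joined-trans (joined x∈j) (joined-trans (joined-sym (joined x∈i)) (joined y∈i)))

    encloses : ∀ i → Encloses U (A i)
    encloses i {y = y} x∈ e with y ∈? U
    ... | yes y∈U = inj₂ y∈U
    ... | no  y∉U = inj₁ (closed x∈ e y∉U)

    disconnects : ∀ i → DisconnectsFromRest G U (A i)
    disconnects i = encloses⇒disconnects (encloses i) (side-nonempty i)
      (λ (x , x∈) → let x∈A , x∈U = x∈p∩q⁻ (A i) U x∈ in side∌ x∈A x∈U)
      -- The rest is nonempty because it contains a vertex of a second side.
      (let j , j≢i = another a≥2 i
           y , y∈j = side-nonempty j
       in y , x∉p⇒x∈∁p ([ side∌ y∈j , j≢i ∘ disjoint y∈j ]′ ∘ x∈p∪q⁻ U (A i)))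

    -- Otherwise U - u would be a smaller cut.
    neighbour-in-side : ∀ {u} i → u ∈ U → ∃[ x ] (x ∈ A i × Adj u x)
    neighbour-in-side {u} i u∈U with any? (λ x → (x ∈? A i) ×-dec adj? u x)
    ... | yes found = found
    ... | no none   = contradiction (minimal (U - u) (disconnects⇒cut D))
                                    (<⇒≱ (<-≤-trans (x∈p⇒∣p-x∣<∣p∣ u∈U) (≤-reflexive size)))
      where
      module D = DisconnectsFromRest (disconnects i)
      U-u⊆U : U - u ⊆ U
      U-u⊆U = p─q⊆p U _
      enc : Encloses (U - u) (A i)
      enc {y = y} x∈ e with encloses i x∈ e
      ... | inj₁ y∈A = inj₁ y∈A
      ... | inj₂ y∈U with y ≟ u
      ...   | yes refl = contradiction (_ , x∈ , symm e) none
      ...   | no y≢u   = inj₂ (x∈p∧x≢y⇒x∈p-y y∈U y≢u)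
      D : DisconnectsFromRest G (U - u) (A i)
      D = encloses⇒disconnects enc D.nonempty
        (λ (x , x∈) → let x∈A , x∈U-u = x∈p∩q⁻ (A i) (U - u) x∈ in side∌ x∈A (U-u⊆U x∈U-u))
        (let y , y∈ = D.rest-nonempty
         in y , x∉p⇒x∈∁p (x∈∁p⇒x∉p y∈ ∘ x∈p∪q⁺ ∘ [ inj₁ ∘ U-u⊆U , inj₂ ]′ ∘ x∈p∪q⁻ (U - u) (A i)))

    -- Induction over a side: its vertices are joined by walks that stay in it, so a property that
    -- holds at one vertex and passes along edges into `A i` reaches all of `A i`.
    side⊆ : ∀ {i x} {Q : Subset n} → x ∈ A i → x ∈ Q →
            (∀ {y z} → y ∈ Q → Adj y z → z ∈ A i → z ∈ Q) → A i ⊆ Q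
    side⊆ {i} {x} {Q} x∈A x∈Q step y∈A = walk x∈A x∈Q (joined-trans (joined-sym (joined x∈A)) (joined y∈A))
      where
      walk : ∀ {x y} → x ∈ A i → x ∈ Q → JoinedIn G (∁ U) x y → y ∈ Q
      walk x∈A x∈Q (ε , _) = x∈Q
      walk x∈A x∈Q (e ◅ p , _ ∷ all) =
        let z∈A = closed x∈A e (x∈∁p⇒x∉p (head∈ (p , all)))
        in walk z∈A (step x∈Q e z∈A) (p , all)

  -- Two minimum cuts

  module Pair {κ : ℕ} {U : Subset n} {a : ℕ} {A : Fin a → Subset n}
              {W : Subset n} {b : ℕ} {B : Fin b → Subset n}
              (u : IsMinimumCut κ U A) (w : IsMinimumCut κ W B) where
    private
      module U = IsMinimumCut u
      module W = IsMinimumCut w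

    -- Both cuts have `κ` vertices, so `U ⊆ W` with `W ≢ U` would be a proper inclusion between sets
    -- of equal size.
    U∖W-nonempty : W ≢ U → ∃[ x ] (x ∈ U × x ∉ W)
    U∖W-nonempty W≢U with any? (λ x → (x ∈? U) ×-dec ¬? (x ∈? W))
    ... | yes found = found
    ... | no none with any? (λ x → (x ∈? W) ×-dec ¬? (x ∈? U))
    ...   | no none′ = contradiction (⊆-antisym (inside-of none′) (inside-of none)) W≢U
      where
      inside-of : ∀ {P Q} → ¬ (∃[ x ] (x ∈ P × x ∉ Q)) → P ⊆ Q
      inside-of {Q = Q} ¬∃ {x} x∈P = decidable-stable (x ∈? Q) (λ x∉Q → ¬∃ (x , x∈P , x∉Q))
    ...   | yes (x , x∈W , x∉U) =
      contradiction (p⊂q⇒∣p∣<∣q∣ (U⊆W , x , x∈W , x∉U)) (<-irrefl (trans U.size (sym W.size)))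
      where
      U⊆W : U ⊆ W
      U⊆W {x} x∈U = decidable-stable (x ∈? W) (λ x∉W → none (x , x∈U , x∉W))

    avoiding-side : ∀ {i} → Empty (W ∩ A i) → ∃[ j ] (A i ⊆ B j × (∀ {x} → x ∈ U → x ∉ W → x ∈ B j))
    avoiding-side {i} avoids = j , A⊆B , U∖W⊆B
      where
      x = proj₁ (U.side-nonempty i)
      A∌ : ∀ {y} → y ∈ A i → y ∉ W
      A∌ y∈A y∈W = avoids (_ , x∈p∩q⁺ (y∈W , y∈A))
      x∈A : x ∈ A i
      x∈A = proj₂ (U.side-nonempty i)
      j = proj₁ (W.cover (A∌ x∈A))
      A⊆B : A i ⊆ B j
      -- A walk inside `A i` never meets `W`, so it cannot leave `B j`: this is `side⊆` with
      -- `Q = B j`.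
      A⊆B = U.side⊆ x∈A (proj₂ (W.cover (A∌ x∈A))) (λ y∈B e z∈A → W.closed y∈B e (A∌ z∈A))
      U∖W⊆B : ∀ {y} → y ∈ U → y ∉ W → y ∈ B j
      U∖W⊆B y∈U y∉W = let z , z∈A , e = U.neighbour-in-side i y∈U in W.closed (A⊆B z∈A) (symm e) y∉W

    module _ {i* : Fin a} {j* : Fin b} (W≢U : W ≢ U) (U∖W⊆B : ∀ {x} → x ∈ U → x ∉ W → x ∈ B j*)
             (W∖U⊆A : ∀ {x} → x ∈ W → x ∉ U → x ∈ A i*) where

      -- Every vertex of `W` outside `U` is in `A i*`, so `A i` misses `W` and lies in a single side
      -- of `W` that also contains the part of `U` outside `W`. That part is nonempty and lies in
      -- `B j*`, which identifies the side.
      other-side⊆ : ∀ {i} → i ≢ i* → A i ⊆ B j*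
      other-side⊆ {i} i≢i* =
        let k , A⊆B , into = avoiding-side {i} (λ (x , x∈) →
              let x∈W , x∈A = x∈p∩q⁻ W (A i) x∈ in i≢i* (U.disjoint x∈A (W∖U⊆A x∈W (U.side∌ x∈A))))
            y , y∈U , y∉W = U∖W-nonempty W≢U
        in subst (λ l → A i ⊆ B l) (W.disjoint (into y∈U y∉W) (U∖W⊆B y∈U y∉W)) A⊆B

      -- The first set identity of the laminar type; exchanging the two cuts gives the second. A
      -- vertex of `B j*` is never in `W`, so outside `A i*` it is either in `U ─ W` or in another
      -- side of `U`.
      side─side : (B j* ─ A i*) ≡ (U ─ W) ∪ ⋃-others A i*
      side─side = ⊆-antisym forward backward
        where
        forward : (B j* ─ A i*) ⊆ (U ─ W) ∪ ⋃-others A i*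
        forward {x} x∈ with x ∈? U
        ... | yes x∈U = p⊆p∪q _ (x∈p∧x∉q⇒x∈p─q x∈U (W.side∌ (p─q⊆p (B j*) (A i*) x∈)))
        ... | no x∉U  = let k , x∈k = U.cover x∉U
                        in q⊆p∪q _ _ (x∈⋃-others⁺ A (λ { refl → x∈p─q⇒x∉q (B j*) (A i*) x∈ x∈k }) x∈k)
        backward : (U ─ W) ∪ ⋃-others A i* ⊆ (B j* ─ A i*)
        backward {x} x∈ with x∈p∪q⁻ (U ─ W) (⋃-others A i*) x∈
        ... | inj₁ x∈U─W = let x∈U = p─q⊆p U W x∈U─W
                           in x∈p∧x∉q⇒x∈p─q (U∖W⊆B x∈U (x∈p─q⇒x∉q U W x∈U─W)) (λ x∈A → U.side∌ x∈A x∈U)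
        ... | inj₂ x∈⋃ = let k , k≢i* , x∈k = x∈⋃-others⁻ A i* x∈⋃
                         in x∈p∧x∉q⇒x∈p─q (other-side⊆ k≢i* x∈k) (k≢i* ∘ U.disjoint x∈k)

    -- Corners and their boundaries

    boundary : Fin a → Fin b → Subset n
    boundary i j = U ∩ B j ∪ (U ∩ W) ∪ W ∩ A i

    x∈boundary⁻ : ∀ {x} i j → x ∈ boundary i j → (x ∈ U × x ∈ B j) ⊎ (x ∈ U × x ∈ W) ⊎ (x ∈ W × x ∈ A i)
    x∈boundary⁻ i j x∈ with x∈p∪q⁻ (U ∩ B j) (U ∩ W ∪ W ∩ A i) x∈
    ... | inj₁ x∈UB = inj₁ (x∈p∩q⁻ U (B j) x∈UB)
    ... | inj₂ x∈TW with x∈p∪q⁻ (U ∩ W) (W ∩ A i) x∈TW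
    ...   | inj₁ x∈T  = inj₂ (inj₁ (x∈p∩q⁻ U W x∈T))
    ...   | inj₂ x∈WA = inj₂ (inj₂ (x∈p∩q⁻ W (A i) x∈WA))

    x∈boundary⁺ : ∀ {x} i j → (x ∈ U × x ∈ B j) ⊎ (x ∈ U × x ∈ W) ⊎ (x ∈ W × x ∈ A i) → x ∈ boundary i j
    x∈boundary⁺ i j (inj₁ x∈)        = p⊆p∪q _ (x∈p∩q⁺ x∈)
    x∈boundary⁺ i j (inj₂ (inj₁ x∈)) = q⊆p∪q (U ∩ B j) _ (p⊆p∪q _ (x∈p∩q⁺ x∈))
    x∈boundary⁺ i j (inj₂ (inj₂ x∈)) = q⊆p∪q (U ∩ B j) _ (q⊆p∪q (U ∩ W) _ (x∈p∩q⁺ x∈))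

    -- A neighbour of the corner that avoids `W` stays in `B j`, and one that avoids `U` stays in
    -- `A i`; the four cases for `U` and `W` give the corner and the three pieces of its boundary.
    boundary-encloses : ∀ i j → Encloses (boundary i j) (A i ∩ B j)
    boundary-encloses i j {y = y} x∈ e with x∈p∩q⁻ (A i) (B j) x∈ | y ∈? U | y ∈? W
    ... | _         | yes y∈U | yes y∈W = inj₂ (x∈boundary⁺ i j (inj₂ (inj₁ (y∈U , y∈W))))
    ... | _ , x∈B   | yes y∈U | no y∉W  = inj₂ (x∈boundary⁺ i j (inj₁ (y∈U , W.closed x∈B e y∉W)))
    ... | x∈A , _   | no y∉U  | yes y∈W = inj₂ (x∈boundary⁺ i j (inj₂ (inj₂ (y∈W , U.closed x∈A e y∉U))))
    ... | x∈A , x∈B | no y∉U  | no y∉W  = inj₁ (x∈p∩q⁺ (U.closed x∈A e y∉U , W.closed x∈B e y∉W))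

    boundary-disconnects : ∀ i j → Nonempty (A i ∩ B j) → DisconnectsFromRest G (boundary i j) (A i ∩ B j)
    boundary-disconnects i j nonempty = encloses⇒disconnects (boundary-encloses i j) nonempty apart rest
      where
      apart : Empty ((A i ∩ B j) ∩ boundary i j)
      apart (x , x∈) with x∈p∩q⁻ (A i ∩ B j) (boundary i j) x∈
      ... | x∈corner , x∈bd with x∈p∩q⁻ (A i) (B j) x∈corner | x∈boundary⁻ i j x∈bd
      ...   | x∈A , _ | inj₁ (x∈U , _)        = U.side∌ x∈A x∈U
      ...   | x∈A , _ | inj₂ (inj₁ (x∈U , _)) = U.side∌ x∈A x∈U
      ...   | _ , x∈B | inj₂ (inj₂ (x∈W , _)) = W.side∌ x∈B x∈W
      rest : Nonempty (∁ (boundary i j ∪ A i ∩ B j))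
      rest =
        -- The boundary and the corner both lie in `U ∪ A i`, so any vertex of another side of `U`
        -- is left over.
        let k , k≢i = another U.a≥2 i
            y , y∈k = U.side-nonempty k
        in y , x∉p⇒x∈∁p λ y∈ → [ (λ y∈bd → [ (λ (y∈U , _) → U.side∌ y∈k y∈U)
                                        , [ (λ (y∈U , _) → U.side∌ y∈k y∈U)
                                          , (λ (_ , y∈A) → k≢i (U.disjoint y∈k y∈A)) ]′ ]′ (x∈boundary⁻ i j y∈bd))
                               , (λ y∈c → k≢i (U.disjoint y∈k (proj₁ (x∈p∩q⁻ (A i) (B j) y∈c)))) ]′
                               (x∈p∪q⁻ (boundary i j) (A i ∩ B j) y∈)

    boundary-cut : ∀ i j → Nonempty (A i ∩ B j) → IsCut G (boundary i j)
    boundary-cut i j = disconnects⇒cut ∘ boundary-disconnects i j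

    ∣boundary∣≥κ : ∀ i j → Nonempty (A i ∩ B j) → κ ≤ ∣ boundary i j ∣
    ∣boundary∣≥κ i j = U.minimal (boundary i j) ∘ boundary-cut i j

    ∣boundary∣ : ∀ i j → ∣ boundary i j ∣ ≡ ∣ U ∩ B j ∣ + (∣ U ∩ W ∣ + ∣ W ∩ A i ∣)
    ∣boundary∣ i j =
      trans (disjoint⇒∣p∪q∣≡∣p∣+∣q∣ (U ∩ B j) (U ∩ W ∪ W ∩ A i) apart₁)
            (cong (∣ U ∩ B j ∣ +_) (disjoint⇒∣p∪q∣≡∣p∣+∣q∣ (U ∩ W) (W ∩ A i) apart₂))
      where
      apart₁ : Empty ((U ∩ B j) ∩ (U ∩ W ∪ W ∩ A i))
      apart₁ (x , x∈) with x∈p∩q⁻ (U ∩ B j) (U ∩ W ∪ W ∩ A i) x∈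
      ... | x∈UB , x∈TW = W.side∌ (proj₂ (x∈p∩q⁻ U (B j) x∈UB))
        ([ proj₂ ∘ x∈p∩q⁻ U W , proj₁ ∘ x∈p∩q⁻ W (A i) ]′ (x∈p∪q⁻ (U ∩ W) (W ∩ A i) x∈TW))
      apart₂ : Empty ((U ∩ W) ∩ (W ∩ A i))
      apart₂ (x , x∈) with x∈p∩q⁻ (U ∩ W) (W ∩ A i) x∈
      ... | x∈T , x∈WA = U.side∌ (proj₂ (x∈p∩q⁻ W (A i) x∈WA)) (proj₁ (x∈p∩q⁻ U W x∈T))

    module _ {j₁ j₂ : Fin b} (only : ∀ j → j ≡ j₁ ⊎ j ≡ j₂) where

      outside-W : ∀ {x} → x ∉ W → x ∈ B j₁ ⊎ x ∈ B j₂
      outside-W {x} x∉W with W.cover x∉W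
      ... | j , x∈B with only j
      ...   | inj₁ refl = inj₁ x∈B
      ...   | inj₂ refl = inj₂ x∈B

      cut-split : U ∩ B j₁ ∪ (U ∩ W) ∪ U ∩ B j₂ ≡ U
      cut-split = ⊆-antisym
        ([ p₁ U , [ p₁ U , p₁ U ]′ ∘ x∈p∪q⁻ (U ∩ W) (U ∩ B j₂) ]′ ∘ x∈p∪q⁻ (U ∩ B j₁) (U ∩ W ∪ U ∩ B j₂))
        split
        where
        p₁ : ∀ p {q : Subset n} {x} → x ∈ p ∩ q → x ∈ p
        p₁ p {q} = proj₁ ∘ x∈p∩q⁻ p q
        split : U ⊆ U ∩ B j₁ ∪ (U ∩ W) ∪ U ∩ B j₂
        split {x} x∈U with x ∈? W
        ... | yes x∈W = q⊆p∪q (U ∩ B j₁) _ (p⊆p∪q _ (x∈p∩q⁺ (x∈U , x∈W)))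
        ... | no x∉W  = [ (λ x∈B → p⊆p∪q _ (x∈p∩q⁺ (x∈U , x∈B)))
                        , (λ x∈B → q⊆p∪q (U ∩ B j₁) _ (q⊆p∪q (U ∩ W) _ (x∈p∩q⁺ (x∈U , x∈B)))) ]′ (outside-W x∉W)

      -- Counts `U` by the same kind of pieces as `∣boundary∣`, so that common terms cancel when the
      -- two are compared.
      ∣cut∣-split : j₁ ≢ j₂ → ∣ U ∩ B j₁ ∣ + (∣ U ∩ W ∣ + ∣ U ∩ B j₂ ∣) ≡ κ
      ∣cut∣-split j₁≢j₂ = begin
        ∣ U ∩ B j₁ ∣ + (∣ U ∩ W ∣ + ∣ U ∩ B j₂ ∣)
          ≡⟨ cong (∣ U ∩ B j₁ ∣ +_) (disjoint⇒∣p∪q∣≡∣p∣+∣q∣ (U ∩ W) (U ∩ B j₂) apart₂) ⟨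
        ∣ U ∩ B j₁ ∣ + ∣ U ∩ W ∪ U ∩ B j₂ ∣
          ≡⟨ disjoint⇒∣p∪q∣≡∣p∣+∣q∣ (U ∩ B j₁) (U ∩ W ∪ U ∩ B j₂) apart₁ ⟨
        ∣ U ∩ B j₁ ∪ (U ∩ W) ∪ U ∩ B j₂ ∣
          ≡⟨ cong ∣_∣ cut-split ⟩
        ∣ U ∣
          ≡⟨ U.size ⟩
        κ ∎
        where
        open ≡-Reasoning
        apart₁ : Empty ((U ∩ B j₁) ∩ (U ∩ W ∪ U ∩ B j₂))
        apart₁ (x , x∈) with x∈p∩q⁻ (U ∩ B j₁) (U ∩ W ∪ U ∩ B j₂) x∈
        ... | x∈UB , x∈TU with proj₂ (x∈p∩q⁻ U (B j₁) x∈UB) | x∈p∪q⁻ (U ∩ W) (U ∩ B j₂) x∈TU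
        ...   | x∈B | inj₁ x∈T   = W.side∌ x∈B (proj₂ (x∈p∩q⁻ U W x∈T))
        ...   | x∈B | inj₂ x∈UB₂ = j₁≢j₂ (W.disjoint x∈B (proj₂ (x∈p∩q⁻ U (B j₂) x∈UB₂)))
        apart₂ : Empty ((U ∩ W) ∩ (U ∩ B j₂))
        apart₂ (x , x∈) with x∈p∩q⁻ (U ∩ W) (U ∩ B j₂) x∈
        ... | x∈T , x∈UB = W.side∌ (proj₂ (x∈p∩q⁻ U (B j₂) x∈UB)) (proj₂ (x∈p∩q⁻ U W x∈T))

      side-split : ∀ i → A i ∩ B j₁ ∪ W ∩ A i ∪ A i ∩ B j₂ ≡ A i
      side-split i = ⊆-antisym
        ([ proj₁ ∘ x∈p∩q⁻ (A i) (B j₁)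
         , [ proj₂ ∘ x∈p∩q⁻ W (A i) , proj₁ ∘ x∈p∩q⁻ (A i) (B j₂) ]′ ∘ x∈p∪q⁻ (W ∩ A i) (A i ∩ B j₂) ]′
         ∘ x∈p∪q⁻ (A i ∩ B j₁) (W ∩ A i ∪ A i ∩ B j₂))
        split
        where
        split : A i ⊆ A i ∩ B j₁ ∪ W ∩ A i ∪ A i ∩ B j₂
        split {x} x∈A with x ∈? W
        ... | yes x∈W = q⊆p∪q (A i ∩ B j₁) _ (p⊆p∪q _ (x∈p∩q⁺ (x∈W , x∈A)))
        ... | no x∉W  = [ (λ x∈B → p⊆p∪q _ (x∈p∩q⁺ (x∈A , x∈B)))
                        , (λ x∈B → q⊆p∪q (A i ∩ B j₁) _ (q⊆p∪q (W ∩ A i) _ (x∈p∩q⁺ (x∈A , x∈B)))) ]′ (outside-W x∉W)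

    -- Boundaries of two opposite corners

    boundary⊆ : ∀ i j → boundary i j ⊆ U ∪ W
    boundary⊆ i j x∈ with x∈boundary⁻ i j x∈
    ... | inj₁ (x∈U , _)        = p⊆p∪q W x∈U
    ... | inj₂ (inj₁ (x∈U , _)) = p⊆p∪q W x∈U
    ... | inj₂ (inj₂ (x∈W , _)) = q⊆p∪q U W x∈W

    ∣U∪W∣+∣U∩W∣ : ∣ U ∪ W ∣ + ∣ U ∩ W ∣ ≡ κ + κ
    ∣U∪W∣+∣U∩W∣ = trans (∣p∪q∣+∣p∩q∣≡∣p∣+∣q∣ U W) (cong₂ _+_ U.size W.size)

    module _ {i₁ i₂ : Fin a} {j₁ j₂ : Fin b} (i₁≢i₂ : i₁ ≢ i₂) (j₁≢j₂ : j₁ ≢ j₂) where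
      private
        X Y : Subset n
        X = boundary i₁ j₁
        Y = boundary i₂ j₂

      boundaries-∪ : X ∪ Y ⊆ U ∪ W
      boundaries-∪ = [ boundary⊆ i₁ j₁ , boundary⊆ i₂ j₂ ]′ ∘ x∈p∪q⁻ X Y

      -- The two pieces in `U` are disjoint because `j₁ ≢ j₂`, the two pieces in `W` because
      -- `i₁ ≢ i₂`. A piece in `U` meets a piece in `W` only within `U ∩ W`.
      boundaries-∩ : X ∩ Y ⊆ U ∩ W
      boundaries-∩ x∈ with x∈p∩q⁻ X Y x∈
      ... | x∈X , x∈Y with x∈boundary⁻ i₁ j₁ x∈X | x∈boundary⁻ i₂ j₂ x∈Y
      ...   | inj₂ (inj₁ x∈T)           | _                         = x∈p∩q⁺ x∈T
      ...   | _                         | inj₂ (inj₁ x∈T)           = x∈p∩q⁺ x∈T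
      ...   | inj₁ (_ , x∈B₁)           | inj₁ (_ , x∈B₂)           = contradiction (W.disjoint x∈B₁ x∈B₂) j₁≢j₂
      ...   | inj₁ (x∈U , _)            | inj₂ (inj₂ (x∈W , _))     = x∈p∩q⁺ (x∈U , x∈W)
      ...   | inj₂ (inj₂ (x∈W , _))     | inj₁ (x∈U , _)            = x∈p∩q⁺ (x∈U , x∈W)
      ...   | inj₂ (inj₂ (_ , x∈A₁))    | inj₂ (inj₂ (_ , x∈A₂))    = contradiction (U.disjoint x∈A₁ x∈A₂) i₁≢i₂

      ∣boundaries∣≤2κ : ∣ X ∣ + ∣ Y ∣ ≤ κ + κ
      ∣boundaries∣≤2κ = subst₂ _≤_ (∣p∪q∣+∣p∩q∣≡∣p∣+∣q∣ X Y) ∣U∪W∣+∣U∩W∣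
        (+-mono-≤ (p⊆q⇒∣p∣≤∣q∣ boundaries-∪) (p⊆q⇒∣p∣≤∣q∣ boundaries-∩))

      -- A vertex of `W` in a third side of `U` belongs to neither boundary, since a boundary meets
      -- the sides of `U` only in `W ∩ A i` for its own `i`. Hence the inclusion of the union in
      -- `U ∪ W` is strict.
      ∣boundaries∣<2κ : ∀ {k x} → k ≢ i₁ → k ≢ i₂ → x ∈ W ∩ A k → ∣ X ∣ + ∣ Y ∣ < κ + κ
      ∣boundaries∣<2κ {k} {x} k≢i₁ k≢i₂ x∈ = subst₂ _<_ (∣p∪q∣+∣p∩q∣≡∣p∣+∣q∣ X Y) ∣U∪W∣+∣U∩W∣
        (+-mono-<-≤ (p⊂q⇒∣p∣<∣q∣ (boundaries-∪ , x , q⊆p∪q U W (proj₁ x∈W×A) , [ x∉ k≢i₁ , x∉ k≢i₂ ]′ ∘ x∈p∪q⁻ X Y))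
                    (p⊆q⇒∣p∣≤∣q∣ boundaries-∩))
        where
        x∈W×A : x ∈ W × x ∈ A k
        x∈W×A = x∈p∩q⁻ W (A k) x∈
        x∉ : ∀ {i j} → k ≢ i → x ∉ boundary i j
        x∉ {i} {j} k≢i x∈bd with x∈boundary⁻ i j x∈bd
        ... | inj₁ (x∈U , _)        = U.side∌ (proj₂ x∈W×A) x∈U
        ... | inj₂ (inj₁ (x∈U , _)) = U.side∌ (proj₂ x∈W×A) x∈U
        ... | inj₂ (inj₂ (_ , x∈A)) = k≢i (U.disjoint (proj₂ x∈W×A) x∈A)

      module _ (corner₁ : Nonempty (A i₁ ∩ B j₁)) (corner₂ : Nonempty (A i₂ ∩ B j₂)) where

        -- Both boundaries have at least `κ` vertices and together at most `κ + κ`, so neither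
        -- exceeds `κ`.
        opposite⇒∣boundary∣≡κ : ∣ X ∣ ≡ κ
        opposite⇒∣boundary∣≡κ = ≤-antisym
          (+-cancelʳ-≤ κ ∣ X ∣ κ (≤-trans (+-monoʳ-≤ ∣ X ∣ (∣boundary∣≥κ i₂ j₂ corner₂)) ∣boundaries∣≤2κ))
          (∣boundary∣≥κ i₁ j₁ corner₁)

        -- A third side would meet `W` and push the two boundaries below `κ + κ` in total, although
        -- each has at least `κ` vertices.
        opposite⇒only : (∀ i → Nonempty (W ∩ A i)) → ∀ k → k ≡ i₁ ⊎ k ≡ i₂
        opposite⇒only meets k with k ≟ i₁ | k ≟ i₂
        ... | yes k≡i₁ | _        = inj₁ k≡i₁
        ... | _        | yes k≡i₂ = inj₂ k≡i₂
        ... | no k≢i₁  | no k≢i₂  = contradiction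
          (+-mono-≤ (∣boundary∣≥κ i₁ j₁ corner₁) (∣boundary∣≥κ i₂ j₂ corner₂))
          (<⇒≱ (∣boundaries∣<2κ k≢i₁ k≢i₂ (proj₂ (meets k))))

    -- Nonempty corners in a single row

    row-empty⇒side⊆ : ∀ {i} → (∀ j → Empty (A i ∩ B j)) → A i ⊆ W
    row-empty⇒side⊆ empty {x} x∈A = decidable-stable (x ∈? W)
      (λ x∉W → let j , x∈B = W.cover x∉W in empty j (x , x∈p∩q⁺ (x∈A , x∈B)))

    -- The other sides of `U` together lie in `W` and miss the vertex `x` of `W ∩ A i`, so they have
    -- fewer than `κ` vertices; `pred-mono-≤` converts this into the bound `κ ∸ 1`.
    one-row⇒small : ∀ i → Nonempty (W ∩ A i) → (∀ k → k ≢ i → ∀ j → Empty (A k ∩ B j)) →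
                    SmallWithSmallSidesIn (κ ∸ 1) A W
    one-row⇒small i (x , x∈) empty = i , small , λ k k≢i → row-empty⇒side⊆ (empty k k≢i)
      where
      x∉others : x ∉ ⋃-others A i
      x∉others x∈⋃ = let k , k≢i , x∈k = x∈⋃-others⁻ A i x∈⋃
                     in k≢i (U.disjoint x∈k (proj₂ (x∈p∩q⁻ W (A i) x∈)))
      others⊆W : ⋃-others A i ⊆ W
      others⊆W y∈⋃ = let k , k≢i , y∈k = x∈⋃-others⁻ A i y∈⋃ in row-empty⇒side⊆ (empty k k≢i) y∈k
      small : IsLargeSide (κ ∸ 1) A i
      small = subst₂ _≤_ (sym (sum-others≡∣⋃-others∣ A U.disjoint i)) (cong (_∸ 1) W.size)
        (pred-mono-≤ (p⊂q⇒∣p∣<∣q∣ (others⊆W , x , proj₁ (x∈p∩q⁻ W (A i) x∈) , x∉others)))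

  -- Laminar and crossing matching types

  module Crossing {κ : ℕ} {U : Subset n} {a : ℕ} {A : Fin a → Subset n}
                  {W : Subset n} {b : ℕ} {B : Fin b → Subset n}
                  (u : IsMinimumCut κ U A) (w : IsMinimumCut κ W B) (W≢U : W ≢ U) where
    private
      module U  = IsMinimumCut u
      module W  = IsMinimumCut w
      module UW = Pair u w
      module WU = Pair w u

    avoiding-side⇒laminar : ∀ {i} → Empty (W ∩ A i) → LaminarType G κ U A W B
    avoiding-side⇒laminar avoids =
      let j* , _ , U∖W⊆B = UW.avoiding-side avoids
          -- `B j` misses `U`: a vertex of `U` in it would be outside `W` and hence in `B j*`. So
          -- `avoiding-side` applies with the cuts exchanged.
          j , j≢j* = another W.a≥2 j*
          i* , _ , W∖U⊆A = WU.avoiding-side {j} (λ (x , x∈) →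
            let x∈U , x∈B = x∈p∩q⁻ U (B j) x∈ in j≢j* (W.disjoint x∈B (U∖W⊆B x∈U (W.side∌ x∈B))))
          W⊆U∪A : W ⊆ U ∪ A i*
          W⊆U∪A {x} x∈W = x∈p∪q⁺ ([ inj₁ , inj₂ ∘ W∖U⊆A x∈W ]′ (toSum (x ∈? U)))
      in (A i* , record { cut = proj₁ U.κ-cut ; side = U.side i* ; other-cut = proj₁ W.κ-cut ; contained = W⊆U∪A })
         , i* , j* , UW.side─side W≢U U∖W⊆B W∖U⊆A , WU.side─side (≢-sym W≢U) W∖U⊆A U∖W⊆B

    -- `LaminarType` treats the cuts asymmetrically, so they are not simply exchanged. Instead the
    -- part of `W` outside `U` is placed in one `A i*`, and any other side of `U` then misses `W`.
    avoiding-side⇒laminar′ : ∀ {j} → Empty (U ∩ B j) → LaminarType G κ U A W B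
    avoiding-side⇒laminar′ avoids =
      let i* , _ , W∖U⊆A = WU.avoiding-side avoids
          i , i≢i* = another U.a≥2 i*
      in avoiding-side⇒laminar {i} (λ (x , x∈) →
           let x∈W , x∈A = x∈p∩q⁻ W (A i) x∈ in i≢i* (U.disjoint x∈A (W∖U⊆A x∈W (U.side∌ x∈A))))

    corner-swap : ∀ {i j} → Nonempty (A i ∩ B j) → Nonempty (B j ∩ A i)
    corner-swap {i} {j} = subst Nonempty (∩-comm (A i) (B j))

    module _ {i₁ i₂ : Fin a} {j₁ j₂ : Fin b} (i₁≢i₂ : i₁ ≢ i₂) (j₁≢j₂ : j₁ ≢ j₂)
             (onlyA : ∀ i → i ≡ i₁ ⊎ i ≡ i₂) (onlyB : ∀ j → j ≡ j₁ ⊎ j ≡ j₂)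
             (corner₁ : Nonempty (A i₁ ∩ B j₁)) (corner₂ : Nonempty (A i₂ ∩ B j₂)) where

      -- Both `W` and the boundary of the first corner have `κ` vertices and share the pieces
      -- `U ∩ W` and `W ∩ A i₁`; the remaining pieces therefore have equal size.
      opposite⇒∣W₂∣≡∣U₁∣ : ∣ W ∩ A i₂ ∣ ≡ ∣ U ∩ B j₁ ∣
      opposite⇒∣W₂∣≡∣U₁∣ = +-cancelˡ-≡ (∣ W ∩ A i₁ ∣ + ∣ U ∩ W ∣) _ _ (begin
        ∣ W ∩ A i₁ ∣ + ∣ U ∩ W ∣ + ∣ W ∩ A i₂ ∣   ≡⟨ +-assoc ∣ W ∩ A i₁ ∣ _ _ ⟩
        ∣ W ∩ A i₁ ∣ + (∣ U ∩ W ∣ + ∣ W ∩ A i₂ ∣) ≡⟨ cong (λ t → ∣ W ∩ A i₁ ∣ + (∣ t ∣ + ∣ W ∩ A i₂ ∣)) (∩-comm U W) ⟩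
        ∣ W ∩ A i₁ ∣ + (∣ W ∩ U ∣ + ∣ W ∩ A i₂ ∣) ≡⟨ WU.∣cut∣-split onlyA i₁≢i₂ ⟩
        κ                                         ≡⟨ UW.opposite⇒∣boundary∣≡κ i₁≢i₂ j₁≢j₂ corner₁ corner₂ ⟨
        ∣ UW.boundary i₁ j₁ ∣                     ≡⟨ UW.∣boundary∣ i₁ j₁ ⟩
        ∣ U ∩ B j₁ ∣ + (∣ U ∩ W ∣ + ∣ W ∩ A i₁ ∣) ≡⟨ +-comm ∣ U ∩ B j₁ ∣ _ ⟩
        ∣ U ∩ W ∣ + ∣ W ∩ A i₁ ∣ + ∣ U ∩ B j₁ ∣   ≡⟨ cong (_+ ∣ U ∩ B j₁ ∣) (+-comm ∣ U ∩ W ∣ _) ⟩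
        ∣ W ∩ A i₁ ∣ + ∣ U ∩ W ∣ + ∣ U ∩ B j₁ ∣   ∎)
        where open ≡-Reasoning

      -- The boundary of the third corner has at least as many vertices as `U`. Removing `U ∩ B j₁`
      -- and `U ∩ W` from both leaves `W ∩ A i₂` against `U ∩ B j₂`.
      third-corner⇒∣U₂∣≤∣U₁∣ : Nonempty (A i₂ ∩ B j₁) → ∣ U ∩ B j₁ ∣ ≥ ∣ U ∩ B j₂ ∣
      third-corner⇒∣U₂∣≤∣U₁∣ corner₃ =
        +-cancelˡ-≤ ∣ U ∩ W ∣ _ _ (+-cancelˡ-≤ ∣ U ∩ B j₁ ∣ _ _ (begin
          ∣ U ∩ B j₁ ∣ + (∣ U ∩ W ∣ + ∣ U ∩ B j₂ ∣) ≡⟨ UW.∣cut∣-split onlyB j₁≢j₂ ⟩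
          κ                                         ≤⟨ UW.∣boundary∣≥κ i₂ j₁ corner₃ ⟩
          ∣ UW.boundary i₂ j₁ ∣                     ≡⟨ UW.∣boundary∣ i₂ j₁ ⟩
          ∣ U ∩ B j₁ ∣ + (∣ U ∩ W ∣ + ∣ W ∩ A i₂ ∣) ≡⟨ cong (λ m → ∣ U ∩ B j₁ ∣ + (∣ U ∩ W ∣ + m)) opposite⇒∣W₂∣≡∣U₁∣ ⟩
          ∣ U ∩ B j₁ ∣ + (∣ U ∩ W ∣ + ∣ U ∩ B j₁ ∣) ∎))
        where open ≤-Reasoning

      private
        -- The set that `IsCrossingMatchingCut` requires to be a matching cut, for `P = U ∩ B j₂`.
        M : Subset n
        M = (U ─ U ∩ B j₂) ∪ W ∩ A i₁

      -- Since `W` has only two sides, removing `U ∩ B j₂` from `U` leaves `U ∩ B j₁` and `U ∩ W`.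
      -- The size and separation results for boundaries thus carry over to `M`.
      M≡boundary : M ≡ UW.boundary i₁ j₁
      M≡boundary = ⊆-antisym forward backward
        where
        forward : M ⊆ UW.boundary i₁ j₁
        forward {x} x∈ with x∈p∪q⁻ (U ─ U ∩ B j₂) (W ∩ A i₁) x∈
        ... | inj₂ x∈WA = UW.x∈boundary⁺ i₁ j₁ (inj₂ (inj₂ (x∈p∩q⁻ W (A i₁) x∈WA)))
        ... | inj₁ x∈U─ with p─q⊆p U (U ∩ B j₂) x∈U─ | x ∈? W
        ...   | x∈U | yes x∈W = UW.x∈boundary⁺ i₁ j₁ (inj₂ (inj₁ (x∈U , x∈W)))
        ...   | x∈U | no x∉W with UW.outside-W onlyB x∉W
        ...     | inj₁ x∈B₁ = UW.x∈boundary⁺ i₁ j₁ (inj₁ (x∈U , x∈B₁))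
        ...     | inj₂ x∈B₂ = contradiction (x∈p∩q⁺ (x∈U , x∈B₂)) (x∈p─q⇒x∉q U (U ∩ B j₂) x∈U─)
        backward : UW.boundary i₁ j₁ ⊆ M
        backward x∈ with UW.x∈boundary⁻ i₁ j₁ x∈
        ... | inj₁ (x∈U , x∈B₁)       = p⊆p∪q _ (x∈p∧x∉q⇒x∈p─q x∈U
          (λ x∈UB₂ → j₁≢j₂ (W.disjoint x∈B₁ (proj₂ (x∈p∩q⁻ U (B j₂) x∈UB₂)))))
        ... | inj₂ (inj₁ (x∈U , x∈W)) = p⊆p∪q _ (x∈p∧x∉q⇒x∈p─q x∈U
          (λ x∈UB₂ → W.side∌ (proj₂ (x∈p∩q⁻ U (B j₂) x∈UB₂)) x∈W))
        ... | inj₂ (inj₂ x∈WA)        = q⊆p∪q (U ─ U ∩ B j₂) _ (x∈p∩q⁺ x∈WA)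

      module _ (corner-empty : Empty (A i₁ ∩ B j₂)) where

        -- With `A i₁ ∩ B j₂` empty, all of `A i₁` outside `W` is in `B j₁`.
        side─M⊆corner : A i₁ ─ M ⊆ A i₁ ∩ B j₁
        side─M⊆corner {x} x∈ with p─q⊆p (A i₁) M x∈
        ... | x∈A with UW.outside-W onlyB
                         (λ x∈W → x∈p─q⇒x∉q (A i₁) M x∈ (q⊆p∪q (U ─ U ∩ B j₂) _ (x∈p∩q⁺ (x∈W , x∈A))))
        ...   | inj₁ x∈B₁ = x∈p∩q⁺ (x∈A , x∈B₁)
        ...   | inj₂ x∈B₂ = contradiction (x , x∈p∩q⁺ (x∈A , x∈B₂)) corner-empty

        empty-corner⇒matching : IsMatchingCut G κ U (A i₁) (U ∩ B j₂) M
        empty-corner⇒matching = record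
          { cut       = proj₁ U.κ-cut
          ; side      = U.side i₁
          ; P⊆U       = proj₁ ∘ x∈p∩q⁻ U (B j₂)
          ; κ-cut     = subst (IsCutOfSize G κ) (sym M≡boundary)
                          ( UW.boundary-cut i₁ j₁ corner₁
                          , UW.opposite⇒∣boundary∣≡κ i₁≢i₂ j₁≢j₂ corner₁ corner₂ )
          ; lower     = p⊆p∪q _
          ; upper     = [ p⊆p∪q _ ∘ p─q⊆p U (U ∩ B j₂) , q⊆p∪q U _ ∘ proj₂ ∘ x∈p∩q⁻ W (A i₁) ]′
                        ∘ x∈p∪q⁻ (U ─ U ∩ B j₂) (W ∩ A i₁)
          ; nonempty  =
              let x , x∈ = corner₁
              in x , x∈p∧x∉q⇒x∈p─q (proj₁ (x∈p∩q⁻ (A i₁) (B j₁) x∈))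
                       (λ x∈M → DisconnectsFromRest.disjoint (UW.boundary-disconnects i₁ j₁ corner₁)
                                  (x , x∈p∩q⁺ (x∈ , subst (x ∈_) M≡boundary x∈M)))
          ; separated = record
            { disjointˡ = λ (x , x∈) →
                let x∈P , x∈M = x∈p∩q⁻ (U ∩ B j₂ ∪ ∁ (U ∪ A i₁)) M x∈ in apart x∈P x∈M
            ; disjointʳ = λ (x , x∈) →
                let x∈A─M , x∈M = x∈p∩q⁻ (A i₁ ─ M) M x∈ in x∈p─q⇒x∉q (A i₁) M x∈A─M x∈M
            -- Such a path starts outside the corner `A i₁ ∩ B j₁` and ends inside it, so it meets
            -- the boundary, which is `M`.
            ; separated = λ x∈ y∈ → entering-meets
                (subst (λ S → Encloses S (A i₁ ∩ B j₁)) (sym M≡boundary) (UW.boundary-encloses i₁ j₁))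
                (outside-corner x∈) (side─M⊆corner y∈)
            }
          }
          where
          apart : ∀ {x} → x ∈ U ∩ B j₂ ∪ ∁ (U ∪ A i₁) → x ∉ M
          apart x∈ x∈M with x∈p∪q⁻ (U ∩ B j₂) (∁ (U ∪ A i₁)) x∈ | x∈p∪q⁻ (U ─ U ∩ B j₂) (W ∩ A i₁) x∈M
          ... | inj₁ x∈UB | inj₁ x∈U─ = x∈p─q⇒x∉q U (U ∩ B j₂) x∈U─ x∈UB
          ... | inj₁ x∈UB | inj₂ x∈WA = W.side∌ (proj₂ (x∈p∩q⁻ U (B j₂) x∈UB)) (proj₁ (x∈p∩q⁻ W (A i₁) x∈WA))
          ... | inj₂ x∈∁  | inj₁ x∈U─ = x∈∁p⇒x∉p x∈∁ (p⊆p∪q _ (p─q⊆p U (U ∩ B j₂) x∈U─))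
          ... | inj₂ x∈∁  | inj₂ x∈WA = x∈∁p⇒x∉p x∈∁ (q⊆p∪q U _ (proj₂ (x∈p∩q⁻ W (A i₁) x∈WA)))
          outside-corner : ∀ {x} → x ∈ U ∩ B j₂ ∪ ∁ (U ∪ A i₁) → x ∉ A i₁ ∩ B j₁
          outside-corner x∈ x∈corner with proj₁ (x∈p∩q⁻ (A i₁) (B j₁) x∈corner) | x∈p∪q⁻ (U ∩ B j₂) (∁ (U ∪ A i₁)) x∈
          ... | x∈A | inj₁ x∈UB = U.side∌ x∈A (proj₁ (x∈p∩q⁻ U (B j₂) x∈UB))
          ... | x∈A | inj₂ x∈∁  = x∈∁p⇒x∉p x∈∁ (q⊆p∪q U _ x∈A)

        empty-corner⇒crossing : Nonempty (U ∩ B j₂) → Nonempty (W ∩ A i₂) →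
                                IsCrossingMatchingCut G κ U (A i₁) (A i₂) (U ∩ B j₂) W
        empty-corner⇒crossing U₂≠∅ W₂≠∅ = record
          { cut        = proj₁ U.κ-cut
          ; side-A     = U.side i₁
          ; side-B     = U.side i₂
          ; A≢B        = i₁≢i₂ ∘ U.distinct
          ; only-sides = only-sides
          ; P-nonempty = U₂≠∅
          ; P⊆U        = proj₁ ∘ x∈p∩q⁻ U (B j₂)
          ; κ-cut      = W.κ-cut
          ; crosses    = W₂≠∅
          ; matching   = empty-corner⇒matching
          }
          where
          only-sides : ∀ Q → IsSide G U Q → Q ≡ A i₁ ⊎ Q ≡ A i₂
          only-sides Q Q-side with U.exhaustive Q Q-side
          ... | i , refl with onlyA i
          ...   | inj₁ refl = inj₁ refl
          ...   | inj₂ refl = inj₂ refl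

    module _ {i₁ i₂ : Fin a} {j₁ j₂ : Fin b} (i₁≢i₂ : i₁ ≢ i₂) (j₁≢j₂ : j₁ ≢ j₂)
             (onlyA : ∀ i → i ≡ i₁ ⊎ i ≡ i₂) (onlyB : ∀ j → j ≡ j₁ ⊎ j ≡ j₂)
             (corner₁ : Nonempty (A i₁ ∩ B j₁)) (corner₂ : Nonempty (A i₂ ∩ B j₂))
             (meetsA : ∀ i → Nonempty (W ∩ A i)) (meetsB : ∀ j → Nonempty (U ∩ B j)) where

      empty-corner⇒crossing-type : Empty (A i₁ ∩ B j₂) → CrossingMatchingType G κ U A W B
      empty-corner⇒crossing-type corner-empty =
        two-valued⇒2 U.a≥2 i₁ i₂ onlyA , two-valued⇒2 W.a≥2 j₁ j₂ onlyB
        , i₁ , i₂ , j₁ , j₂ , i₁≢i₂ , j₁≢j₂ , corner₁ , corner₂ , corner-empty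
        , opposite⇒∣W₂∣≡∣U₁∣ i₁≢i₂ j₁≢j₂ onlyA onlyB corner₁ corner₂
        , Nonempty⇒∣p∣>0 (meetsB j₁)
        -- The second equality is the first with the two corners exchanged.
        , opposite⇒∣W₂∣≡∣U₁∣ (≢-sym i₁≢i₂) (≢-sym j₁≢j₂) (swap ∘ onlyA) (swap ∘ onlyB) corner₂ corner₁
        , Nonempty⇒∣p∣>0 (meetsB j₂)
        , empty-corner⇒crossing i₁≢i₂ j₁≢j₂ onlyA onlyB corner₁ corner₂ corner-empty (meetsB j₂) (meetsA i₂)
        , third-corner⇒∣U₂∣≤∣U₁∣ i₁≢i₂ j₁≢j₂ onlyA onlyB corner₁ corner₂

  -- The 4-wheel

  module Wheel {κ : ℕ} {U W : Subset n} {A B : Fin 2 → Subset n}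
               (u : IsMinimumCut κ U A) (w : IsMinimumCut κ W B)
               (corners : ∀ i j → Nonempty (A i ∩ B j))
               (meetsA : ∀ i → Nonempty (W ∩ A i)) (meetsB : ∀ j → Nonempty (U ∩ B j)) where
    private
      module U  = IsMinimumCut u
      module W  = IsMinimumCut w
      module UW = Pair u w
      module WU = Pair w u

    spoke sector : Fin 4 → Subset n
    spoke  = lookup (U ∩ B 0F ∷ W ∩ A 0F ∷ U ∩ B 1F ∷ W ∩ A 1F ∷ [])
    sector = lookup (A 0F ∩ B 0F ∷ A 0F ∩ B 1F ∷ A 1F ∩ B 1F ∷ A 1F ∩ B 0F ∷ [])

    U-spoke W-spoke : Fin 2 → Fin 4
    U-spoke 0F = 0F
    U-spoke 1F = 2F
    W-spoke 0F = 1F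
    W-spoke 1F = 3F

    -- Corners in cyclic order: consecutive ones share alternately a side of `U` and a side of `W`,
    -- and the spoke at the second of their indices is what that side has in the other cut.
    sector-of : Fin 2 → Fin 2 → Fin 4
    sector-of 0F 0F = 0F
    sector-of 0F 1F = 1F
    sector-of 1F 1F = 2F
    sector-of 1F 0F = 3F

    -- Describes all spokes uniformly, so that disjointness follows from that of the sides without a
    -- case for each pair of indices; `x∈sector⁻` does the same for sectors.
    x∈spoke⁻ : ∀ {x} k → x ∈ spoke k →
               (∃[ j ] (k ≡ U-spoke j × x ∈ U × x ∈ B j)) ⊎ (∃[ i ] (k ≡ W-spoke i × x ∈ W × x ∈ A i))
    x∈spoke⁻ 0F x∈ = inj₁ (0F , refl , x∈p∩q⁻ U (B 0F) x∈)
    x∈spoke⁻ 1F x∈ = inj₂ (0F , refl , x∈p∩q⁻ W (A 0F) x∈)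
    x∈spoke⁻ 2F x∈ = inj₁ (1F , refl , x∈p∩q⁻ U (B 1F) x∈)
    x∈spoke⁻ 3F x∈ = inj₂ (1F , refl , x∈p∩q⁻ W (A 1F) x∈)

    x∈sector⁻ : ∀ {x} k → x ∈ sector k → ∃[ i ] ∃[ j ] (k ≡ sector-of i j × x ∈ A i × x ∈ B j)
    x∈sector⁻ 0F x∈ = 0F , 0F , refl , x∈p∩q⁻ (A 0F) (B 0F) x∈
    x∈sector⁻ 1F x∈ = 0F , 1F , refl , x∈p∩q⁻ (A 0F) (B 1F) x∈
    x∈sector⁻ 2F x∈ = 1F , 1F , refl , x∈p∩q⁻ (A 1F) (B 1F) x∈
    x∈sector⁻ 3F x∈ = 1F , 0F , refl , x∈p∩q⁻ (A 1F) (B 0F) x∈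

    U-spoke≡ : ∀ j → spoke (U-spoke j) ≡ U ∩ B j
    U-spoke≡ 0F = refl
    U-spoke≡ 1F = refl

    W-spoke≡ : ∀ i → spoke (W-spoke i) ≡ W ∩ A i
    W-spoke≡ 0F = refl
    W-spoke≡ 1F = refl

    sector-of≡ : ∀ i j → sector (sector-of i j) ≡ A i ∩ B j
    sector-of≡ 0F 0F = refl
    sector-of≡ 0F 1F = refl
    sector-of≡ 1F 0F = refl
    sector-of≡ 1F 1F = refl

    T∩spoke : ∀ k → Empty ((U ∩ W) ∩ spoke k)
    T∩spoke k (x , x∈) with x∈p∩q⁻ (U ∩ W) (spoke k) x∈
    ... | x∈T , x∈C with x∈p∩q⁻ U W x∈T | x∈spoke⁻ k x∈C
    ...   | _ , x∈W | inj₁ (_ , _ , _ , x∈B) = W.side∌ x∈B x∈W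
    ...   | x∈U , _ | inj₂ (_ , _ , _ , x∈A) = U.side∌ x∈A x∈U

    T∩sector : ∀ k → Empty ((U ∩ W) ∩ sector k)
    T∩sector k (x , x∈) =
      let x∈T , x∈S = x∈p∩q⁻ (U ∩ W) (sector k) x∈
          _ , _ , _ , x∈A , _ = x∈sector⁻ k x∈S
      in U.side∌ x∈A (proj₁ (x∈p∩q⁻ U W x∈T))

    spoke∩sector : ∀ k l → Empty (spoke k ∩ sector l)
    spoke∩sector k l (x , x∈) with x∈p∩q⁻ (spoke k) (sector l) x∈
    ... | x∈C , x∈S with x∈spoke⁻ k x∈C | x∈sector⁻ l x∈S
    ...   | inj₁ (_ , _ , x∈U , _) | _ , _ , _ , x∈A , _ = U.side∌ x∈A x∈U
    ...   | inj₂ (_ , _ , x∈W , _) | _ , _ , _ , _ , x∈B = W.side∌ x∈B x∈W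

    spoke∩spoke : ∀ k l → k ≢ l → Empty (spoke k ∩ spoke l)
    spoke∩spoke k l k≢l (x , x∈) with x∈p∩q⁻ (spoke k) (spoke l) x∈
    ... | x∈k , x∈l with x∈spoke⁻ k x∈k | x∈spoke⁻ l x∈l
    ...   | inj₁ (_ , refl , _ , x∈B) | inj₁ (_ , refl , _ , x∈B′) = k≢l (cong U-spoke (W.disjoint x∈B x∈B′))
    ...   | inj₁ (_ , _ , x∈U , _)    | inj₂ (_ , _ , _ , x∈A)     = U.side∌ x∈A x∈U
    ...   | inj₂ (_ , _ , _ , x∈A)    | inj₁ (_ , _ , x∈U , _)     = U.side∌ x∈A x∈U
    ...   | inj₂ (_ , refl , _ , x∈A) | inj₂ (_ , refl , _ , x∈A′) = k≢l (cong W-spoke (U.disjoint x∈A x∈A′))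

    sector∩sector : ∀ k l → k ≢ l → Empty (sector k ∩ sector l)
    sector∩sector k l k≢l (x , x∈) with x∈p∩q⁻ (sector k) (sector l) x∈
    ... | x∈k , x∈l with x∈sector⁻ k x∈k | x∈sector⁻ l x∈l
    ...   | _ , _ , refl , x∈A , x∈B | _ , _ , refl , x∈A′ , x∈B′ =
      k≢l (cong₂ sector-of (U.disjoint x∈A x∈A′) (W.disjoint x∈B x∈B′))

    covered : ∀ x → x ∈ U ∩ W ⊎ (∃[ k ] x ∈ spoke k) ⊎ (∃[ k ] x ∈ sector k)
    covered x with x ∈? U | x ∈? W
    ... | yes x∈U | yes x∈W = inj₁ (x∈p∩q⁺ (x∈U , x∈W))
    ... | yes x∈U | no x∉W  =
      let j , x∈B = W.cover x∉W in inj₂ (inj₁ (U-spoke j , subst (x ∈_) (sym (U-spoke≡ j)) (x∈p∩q⁺ (x∈U , x∈B))))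
    ... | no x∉U  | yes x∈W =
      let i , x∈A = U.cover x∉U in inj₂ (inj₁ (W-spoke i , subst (x ∈_) (sym (W-spoke≡ i)) (x∈p∩q⁺ (x∈W , x∈A))))
    ... | no x∉U  | no x∉W  =
      let i , x∈A = U.cover x∉U
          j , x∈B = W.cover x∉W
      in inj₂ (inj₂ (sector-of i j , subst (x ∈_) (sym (sector-of≡ i j)) (x∈p∩q⁺ (x∈A , x∈B))))

    only01 : ∀ (i : Fin 2) → i ≡ 0F ⊎ i ≡ 1F
    only01 0F = inj₁ refl
    only01 1F = inj₂ refl

    U-split : ∀ {j₁ j₂} → (∀ j → j ≡ j₁ ⊎ j ≡ j₂) → U ≡ U ∩ B j₁ ∪ (U ∩ W) ∪ U ∩ B j₂
    U-split only = sym (UW.cut-split only)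

    W-split : ∀ {i₁ i₂} → (∀ i → i ≡ i₁ ⊎ i ≡ i₂) → W ≡ W ∩ A i₁ ∪ (U ∩ W) ∪ W ∩ A i₂
    -- `WU` names the common part `W ∩ U`, while the wheel has `U ∩ W`.
    W-split {i₁} {i₂} only = trans (sym (WU.cut-split only)) (cong (λ T → W ∩ A i₁ ∪ T ∪ W ∩ A i₂) (∩-comm W U))

    A-split : ∀ i {j₁ j₂} → (∀ j → j ≡ j₁ ⊎ j ≡ j₂) → A i ≡ A i ∩ B j₁ ∪ W ∩ A i ∪ A i ∩ B j₂
    A-split i only = sym (UW.side-split only i)

    B-split : ∀ j {i₁ i₂} → (∀ i → i ≡ i₁ ⊎ i ≡ i₂) → B j ≡ A i₁ ∩ B j ∪ U ∩ B j ∪ A i₂ ∩ B j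
    B-split j {i₁} {i₂} only = trans (sym (WU.side-split only j))
      (cong₂ (λ P Q → P ∪ U ∩ B j ∪ Q) (∩-comm (B j) (A i₁)) (∩-comm (B j) (A i₂)))

    wheel : IsWheel G κ (U ∩ W) spoke sector
    wheel = record
      { w≥4        = ≤-refl
      ; C-nonempty = λ { 0F → meetsB 0F ; 1F → meetsA 0F ; 2F → meetsB 1F ; 3F → meetsA 1F }
      ; S-nonempty = λ { 0F → corners 0F 0F ; 1F → corners 0F 1F ; 2F → corners 1F 1F ; 3F → corners 1F 0F }
      ; T∩C        = T∩spoke
      ; T∩S        = T∩sector
      ; C∩S        = spoke∩sector
      ; C∩C        = spoke∩spoke
      ; S∩S        = sector∩sector
      ; cover      = covered
      -- Opposite spokes together with `U ∩ W` form `U` at even indices and `W` at odd ones. Indices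
      -- 2 and 3 list the two spokes in reverse order, hence `swap`.
      ; cut        = λ
        { 0F → subst (IsCutOfSize G κ) (U-split only01) U.κ-cut
        ; 1F → subst (IsCutOfSize G κ) (W-split only01) W.κ-cut
        ; 2F → subst (IsCutOfSize G κ) (U-split (swap ∘ only01)) U.κ-cut
        ; 3F → subst (IsCutOfSize G κ) (W-split (swap ∘ only01)) W.κ-cut
        }
      -- Two consecutive sectors and the spoke between them form the sides `A 0F`, `B 1F`, `A 1F`,
      -- `B 0F` in turn.
      ; separated  = λ
        { 0F → subst₂ (DisconnectsFromRest G) (U-split only01) (A-split 0F only01) (U.disconnects 0F)
        ; 1F → subst₂ (DisconnectsFromRest G) (W-split only01) (B-split 1F only01) (W.disconnects 1F)
        ; 2F → subst₂ (DisconnectsFromRest G) (U-split (swap ∘ only01)) (A-split 1F (swap ∘ only01)) (U.disconnects 1F)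
        ; 3F → subst₂ (DisconnectsFromRest G) (W-split (swap ∘ only01)) (B-split 0F (swap ∘ only01)) (W.disconnects 0F)
        }
      }

  -- Matching the equalities with `refl` makes both families of sides indexed by `Fin 2`, where the
  -- casts in `WheelType` compute.
  corners⇒wheel-type : ∀ {κ U W a b} {A : Fin a → Subset n} {B : Fin b → Subset n} → a ≡ 2 → b ≡ 2 →
                       IsMinimumCut κ U A → IsMinimumCut κ W B → (∀ i j → Nonempty (A i ∩ B j)) →
                       (∀ i → Nonempty (W ∩ A i)) → (∀ j → Nonempty (U ∩ B j)) → WheelType G κ U A W B
  corners⇒wheel-type refl refl u w corners meetsA meetsB = refl , refl , Wheel.wheel u w corners meetsA meetsB

  -- Case analysis on the nonempty corners

  module _ {κ : ℕ} {U : Subset n} {a : ℕ} {A : Fin a → Subset n}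
           {W : Subset n} {b : ℕ} {B : Fin b → Subset n}
           (u : IsMinimumCut κ U A) (w : IsMinimumCut κ W B) (W≢U : W ≢ U)
           (meetsA : ∀ i → Nonempty (W ∩ A i)) (meetsB : ∀ j → Nonempty (U ∩ B j)) where
    private
      module U  = IsMinimumCut u
      module W  = IsMinimumCut w
      module UW = Pair u w
      module WU = Pair w u
      open Crossing u w W≢U

      corner? : ∀ i j → Dec (Nonempty (A i ∩ B j))
      corner? i j = nonempty? (A i ∩ B j)

    opposite-corners : ∀ {i₁ i₂ j₁ j₂} → i₁ ≢ i₂ → j₁ ≢ j₂ → Nonempty (A i₁ ∩ B j₁) → Nonempty (A i₂ ∩ B j₂) →
                       WheelType G κ U A W B ⊎ CrossingMatchingType G κ U A W B
    opposite-corners {i₁} {i₂} {j₁} {j₂} i₁≢i₂ j₁≢j₂ corner₁ corner₂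
      with UW.opposite⇒only i₁≢i₂ j₁≢j₂ corner₁ corner₂ meetsA
         | WU.opposite⇒only j₁≢j₂ i₁≢i₂ (corner-swap corner₁) (corner-swap corner₂) meetsB
         | corner? i₁ j₂ | corner? i₂ j₁
    ... | onlyA | onlyB | no empty | _ =
      inj₂ (empty-corner⇒crossing-type i₁≢i₂ j₁≢j₂ onlyA onlyB corner₁ corner₂ meetsA meetsB empty)
    ... | onlyA | onlyB | yes _ | no empty =
      -- The empty corner has to take the place of `A i₁ ∩ B j₂`, so the sides of both cuts are
      -- renamed.
      inj₂ (empty-corner⇒crossing-type (≢-sym i₁≢i₂) (≢-sym j₁≢j₂) (swap ∘ onlyA) (swap ∘ onlyB)
                                       corner₂ corner₁ meetsA meetsB empty)
    ... | onlyA | onlyB | yes corner₃ | yes corner₄ =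
      inj₁ (corners⇒wheel-type (two-valued⇒2 U.a≥2 i₁ i₂ onlyA) (two-valued⇒2 W.a≥2 j₁ j₂ onlyB) u w corners meetsA meetsB)
      where
      corners : ∀ i j → Nonempty (A i ∩ B j)
      corners i j with onlyA i | onlyB j
      ... | inj₁ refl | inj₁ refl = corner₁
      ... | inj₁ refl | inj₂ refl = corner₃
      ... | inj₂ refl | inj₁ refl = corner₄
      ... | inj₂ refl | inj₂ refl = corner₂

    crossing-cuts : WheelType G κ U A W B ⊎ CrossingMatchingType G κ U A W B ⊎ SmallType G κ U A W B
    crossing-cuts with any? (λ i → any? (λ j → corner? i j))
    -- With no nonempty corner at all, any side of `U` can serve as the large one.
    ... | no none = inj₂ (inj₂ (inj₁ (UW.one-row⇒small i₀ (meetsA i₀) (λ k _ j c → none (k , j , c)))))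
      where
      i₀ : Fin a
      i₀ = inject≤ 0F U.a≥2
    ... | yes (i , j , corner) with any? (λ k → ¬? (k ≟ i) ×-dec any? (λ l → ¬? (l ≟ j) ×-dec corner? k l))
    ...   | yes (k , k≢i , l , l≢j , corner′) =
      [ inj₁ , inj₂ ∘ inj₁ ]′ (opposite-corners (≢-sym k≢i) (≢-sym l≢j) corner corner′)
    ...   | no no-opposite
            with any? (λ k → ¬? (k ≟ i) ×-dec corner? k j) | any? (λ l → ¬? (l ≟ j) ×-dec corner? i l)
    -- The corners at `(k , j)` and `(i , l)` are themselves in different rows and columns.
    ...     | yes (k , k≢i , corner′) | yes (l , l≢j , corner″) =
      [ inj₁ , inj₂ ∘ inj₁ ]′ (opposite-corners k≢i (≢-sym l≢j) corner′ corner″)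
    -- No nonempty corner lies off both row `i` and column `j`, and none in column `j` lies off row
    -- `i`, so all are in row `i`.
    ...     | no column-empty | _ = inj₂ (inj₂ (inj₁ (UW.one-row⇒small i (meetsA i) one-row)))
      where
      one-row : ∀ k → k ≢ i → ∀ l → Empty (A k ∩ B l)
      one-row k k≢i l c with l ≟ j
      ... | yes refl = column-empty (k , k≢i , c)
      ... | no l≢j   = no-opposite (k , k≢i , l , l≢j , c)
    ...     | yes _ | no row-empty = inj₂ (inj₂ (inj₂ (WU.one-row⇒small j (meetsB j) one-column)))
      where
      one-column : ∀ l → l ≢ j → ∀ k → Empty (B l ∩ A k)
      one-column l l≢j k c with k ≟ i
      ... | yes refl = row-empty (l , l≢j , subst Nonempty (∩-comm (B l) (A k)) c)
      ... | no k≢i   = no-opposite (k , k≢i , l , l≢j , subst Nonempty (∩-comm (B l) (A k)) c)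

  minimum-cuts : ∀ {κ U W a b} {A : Fin a → Subset n} {B : Fin b → Subset n} →
                 IsMinimumCut κ U A → IsMinimumCut κ W B → W ≢ U →
                 LaminarType G κ U A W B ⊎ WheelType G κ U A W B ⊎ CrossingMatchingType G κ U A W B ⊎ SmallType G κ U A W B
  minimum-cuts {U = U} {W} {A = A} {B} u w W≢U
    with any? (λ i → ¬? (nonempty? (W ∩ A i))) | any? (λ j → ¬? (nonempty? (U ∩ B j)))
  ... | yes (_ , avoids) | _                = inj₁ (Crossing.avoiding-side⇒laminar u w W≢U avoids)
  ... | no _             | yes (_ , avoids) = inj₁ (Crossing.avoiding-side⇒laminar′ u w W≢U avoids)
  ... | no meetsA        | no meetsB        = inj₂ (crossing-cuts u w W≢U
    (λ i → decidable-stable (nonempty? (W ∩ A i)) (λ empty → meetsA (i , empty)))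
    (λ j → decidable-stable (nonempty? (U ∩ B j)) (λ empty → meetsB (j , empty))))

theorem2 : ∀ {n : ℕ} (G : Graph n) (κ : ℕ)
    → Connected G
    → ¬ Complete G
    → IsVertexConnectivity G κ
    → 4 * κ < n
    → (U : Subset n) {a : ℕ} (A : Fin a → Subset n)
    → IsCutOfSize G κ U → AreSides G U A → a ≥ 2
    → (W : Subset n) {b : ℕ} (B : Fin b → Subset n)
    → IsCutOfSize G κ W → AreSides G W B → b ≥ 2
    → W ≢ U
    → LaminarType G κ U A W B
    ⊎ WheelType G κ U A W B
    ⊎ CrossingMatchingType G κ U A W B
    ⊎ SmallType G κ U A W B
theorem2 G κ _ _ (_ , minimal) _ U A U-cut A-sides a≥2 W B W-cut B-sides b≥2 =
  minimum-cuts G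
    (record { minimal = minimal ; κ-cut = U-cut ; sides = A-sides ; a≥2 = a≥2 })
    (record { minimal = minimal ; κ-cut = W-cut ; sides = B-sides ; a≥2 = b≥2 })
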